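{- Let $\mathsf P$ be a one-move rider with basic move $(c,d)$ and let $q\ge2$. Then $u_{\mathsf P}(q;n)$, as a quasipolynomial function of $n$, has period $\max(|c|,|d|)$.
   Context: A one-move rider has a single basic move $(c,d)\in\mathbb Z^2\setminus\{0\}$ with $\gcd(c,d)=1$. Pieces are placed on the $n\times n$ board $[n]^2=\{1,\dots,n\}^2$; two pieces at positions $z,z'$ attack each other if $z'-z$ is an integer multiple of $(c,d)$ (in particular if $z=z'$). $u_{\mathsf P}(q;n)$ is the number of ways to place $q$ unlabelled pieces on $[n]^2$ with no two attacking each other; it is a quasipolynomial in $n$, and its period is the least $p$ such that it is given by polynomials in $n$ depending only on $n \bmod p$. -}

module Defs where

open import Data.Fin.Base using (Fin)
open import Data.Integer.Base as ℤ using (ℤ; +_; 0ℤ)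
import Data.Integer.Properties as ℤ
import Data.Integer.Divisibility.Signed as ℤ∣
open import Data.List.Base
  using (List; []; _∷_; _++_; map; filter; foldr; length; upTo; cartesianProduct)
open import Data.List.Relation.Unary.AllPairs using (AllPairs; allPairs?)
open import Data.Nat.Base using (ℕ; zero; suc; NonZero; _≤_)
open import Data.Nat.DivMod using (_mod_)
open import Data.Product using (Σ; _×_; _,_; ∃-syntax)
open import Data.Rational.Base as ℚ using (ℚ; 0ℚ)
open import Relation.Binary.PropositionalEquality using (_≡_; refl; sym; trans; cong)
open import Relation.Nullary using (¬_; Dec; yes; no)
open import Relation.Nullary.Decidable using (map′; _×-dec_; ¬?)

Position : Set
Position = ℤ × ℤ

Attacks : ℤ × ℤ → Position → Position → Set
Attacks (c , d) (x , y) (x′ , y′) =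
  ∃[ k ] (x′ ℤ.- x ≡ k ℤ.* c × y′ ℤ.- y ≡ k ℤ.* d)

multiple? : ∀ c d a b → Dec (∃[ k ] (a ≡ k ℤ.* c × b ≡ k ℤ.* d))
multiple? c d a b with c ℤ.≟ 0ℤ
... | yes refl = map′
  (λ { (a≡0 , ℤ∣.divides k b≡kd) →
         k , trans a≡0 (sym (ℤ.*-zeroʳ k)) , b≡kd })
  (λ { (k , a≡k0 , b≡kd) → trans a≡k0 (ℤ.*-zeroʳ k) , ℤ∣.divides k b≡kd })
  ((a ℤ.≟ 0ℤ) ×-dec (d ℤ∣.∣? b))
... | no c≢0 with c ℤ∣.∣? a
...   | no c∤a = no λ { (k , a≡kc , _) → c∤a (ℤ∣.divides k a≡kc) }
...   | yes (ℤ∣.divides k a≡kc) = map′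
  (λ b≡kd → k , a≡kc , b≡kd)
  (λ { (k′ , a≡k′c , b≡k′d) → trans b≡k′d (cong (ℤ._* d) (unique k′ a≡k′c)) })
  (b ℤ.≟ k ℤ.* d)
  where
  unique : ∀ k′ → a ≡ k′ ℤ.* c → k′ ≡ k
  unique k′ e = ℤ.*-cancelʳ-≡ k′ k c {{ℤ.≢-nonZero c≢0}} (trans (sym e) a≡kc)

attacks? : ∀ m z z′ → Dec (Attacks m z z′)
attacks? (c , d) (x , y) (x′ , y′) = multiple? c d (x′ ℤ.- x) (y′ ℤ.- y)

board : ℕ → List Position
board n = cartesianProduct coordinates coordinates
  where
  coordinates : List ℤ
  coordinates = map (λ i → + suc i) (upTo n)

-- All ways to pick q entries of a list, by position and in list order.  For a
-- list without repetitions these are its q-element subsets, each listed once.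
choose : ∀ {A : Set} → ℕ → List A → List (List A)
choose zero    _        = [] ∷ []
choose (suc q) []       = []
choose (suc q) (x ∷ xs) = map (x ∷_) (choose q xs) ++ choose (suc q) xs

-- Attack is symmetric, so testing each pair in list order is enough.
NonAttacking : ℤ × ℤ → List Position → Set
NonAttacking m = AllPairs (λ z z′ → ¬ Attacks m z z′)

nonAttacking? : ∀ m zs → Dec (NonAttacking m zs)
nonAttacking? m = allPairs? (λ z z′ → ¬? (attacks? m z z′))

-- Two pieces on the same square attack each other, so a nonattacking placement
-- of q unlabelled pieces is a q-element subset of the board.
u : ℤ × ℤ → ℕ → ℕ → ℕ
u m q n = length (filter (nonAttacking? m) (choose q (board n)))

-- Coefficients, constant term first.  Rational coefficients lose no generality:
-- a polynomial with integer values at infinitely many integers is rational.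
Polynomial : Set
Polynomial = List ℚ

eval : Polynomial → ℚ → ℚ
eval f x = foldr (λ a r → a ℚ.+ x ℚ.* r) 0ℚ f

fromℕ : ℕ → ℚ
fromℕ n = + n ℚ./ 1

-- f is given on the positive integers by polynomials in n that depend only on
-- n mod p; p need not be least.
QuasipolynomialMod : (ℕ → ℕ) → (p : ℕ) → .{{NonZero p}} → Set
QuasipolynomialMod f p =
  Σ (Fin p → Polynomial) λ g →
    ∀ n → 1 ≤ n → fromℕ (f n) ≡ eval (g (n mod p)) (fromℕ n)

HasPeriod : (ℕ → ℕ) → ℕ → Set
HasPeriod f p =
  (Σ (NonZero p) λ p≢0 → QuasipolynomialMod f p {{p≢0}}) ×
  (∀ p′ → .{{_ : NonZero p′}} → QuasipolynomialMod f p′ → p ≤ p′)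

{-# OPTIONS --safe #-}

-- Write P_i for the sum, over the squares z of the n × n board, of the i-th power
-- of the size of the line through z.  Newton's identities express the number of
-- nonattacking placements through the P_i.  Let a ≤ b be |c| and |d| in order, and
-- let θ be the fractional part of y = n / b.  Two summations by parts write P_i as
-- a polynomial in y and in the values at y of the linear interpolants, between the
-- integers next to y, of two polynomials H that do not depend on n.  For fixed θ,
-- that is, for fixed n mod b, this is a polynomial in y.
--
-- Interpolation changes H by θ (1 - θ) H″ / 2 to leading order.  Hence P_i, of
-- degree at most i + 2, depends on θ only in degrees at most i, and passing from 0
-- to θ raises the coefficient of y in P_1 by b (b - a) θ (1 - θ), which is positive
-- when b > 1.  Through Newton's identities, the coefficient of y^(2q-3) in u is
-- strictly smaller for 0 < θ < 1 than for θ = 0.  A period p < b would force the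
-- polynomials for θ = 0 and θ = p / b to coincide.

module Submission where

open import Defs
import Data.Fin.Base as Fin
import Data.Fin.Properties as Fin
open import Data.Integer.Base as ℤ using (ℤ; ∣_∣; -[1+_]; +[1+_]; 0ℤ; 1ℤ; +<+; +≤+)
open import Data.Integer.GCD using (gcd)
import Data.Integer.Properties as ℤ
import Data.Integer.Tactic.RingSolver as ℤSolver
open import Data.List.Base
  using (List; []; _∷_; _++_; map; filter; length; applyUpTo; upTo; cartesianProduct)
open import Data.List.Properties
  using (filter-≐; filter-++; filter-accept; filter-reject; length-++)
open import Data.List.Relation.Unary.All as All using (All; []; _∷_; all?)
import Data.List.Relation.Unary.All.Properties as All
open import Data.List.Relation.Unary.AllPairs as AllPairs using (AllPairs; []; _∷_; allPairs?)
import Data.List.Relation.Unary.AllPairs.Properties as AllPairs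
open import Data.Nat.Base as ℕ using (ℕ; zero; suc; _∸_; _⊓_; _≤_; _⊔_)
import Data.Nat.Divisibility as ℕ
open import Data.Nat.DivMod as ℕ using (_mod_)
import Data.Nat.GCD as ℕ
import Data.Nat.Properties as ℕ
import Data.Nat.Tactic.RingSolver as ℕSolver
open import Data.Product.Base using (Σ; ∃; ∃₂; _×_; _,_; proj₁; proj₂)
open import Data.Rational.Base as ℚ
  using (ℚ; 0ℚ; 1ℚ; _+_; _*_; _-_; -_; 1/_; _/_; toℚᵘ; positive; ≢-nonZero)
open import Data.Rational.Properties as ℚ using
  ( toℚᵘ-injective; toℚᵘ-fromℚᵘ; toℚᵘ-homo-+; toℚᵘ-homo-*; toℚᵘ-cancel-<
  ; positive⁻¹; pos*pos⇒pos; +-*-commutativeRing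
  ; +-identityˡ; +-identityʳ; +-inverseʳ; *-identityˡ; *-identityʳ; *-zeroˡ; *-zeroʳ
  ; *-inverseˡ; *-distribˡ-+; *-distribʳ-+ )
import Data.Rational.Unnormalised.Base as ℚᵘ
import Data.Rational.Unnormalised.Properties as ℚᵘ
open import Algebra.Properties.Group ℚ.+-0-group using () renaming (∙-cancelʳ to +-cancelʳ)
open import Data.Sum.Base using (_⊎_; inj₁; inj₂)
open import Function.Base using (_∘_; id)
open import Level using (0ℓ)
open import Relation.Binary.Core using (Rel)
open import Relation.Binary.PropositionalEquality
open import Relation.Binary.Structures using (IsDecEquivalence)
open import Relation.Nullary using (¬_; Dec; yes; no; contradiction)
open import Relation.Nullary.Decidable using (_×-dec_; ¬?)
open import Relation.Nullary.Decidable.Core using (dec⇒maybe)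
open import Relation.Unary using (Pred; Decidable; _≐_)
open import Tactic.RingSolver using (solve-∀)
import Tactic.RingSolver.Core.AlmostCommutativeRing as ACR

-- Why the degree 2q - 3, and why nothing cancels there: by Newton's identities u is a combination
-- of products of moments P_i in which the numbers i + 1 add up to q. A product of m factors has
-- degree at most q + m, and θ affects it only in degrees at most q + m - 2. For m = q the product
-- is P_0^q, and P_0 = n^2 does not depend on θ. For m = q - 1 the only product is P_0^(q-2) P_1. It
-- enters with a negative sign, so a rise of P_1 lowers u in degree 2q - 3, which no other product
-- reaches.
--
-- The residue of n enters only through truncation: the number of squares z for which z + k (c, d)
-- is still on the board is (n - k a)(n - k b) while k b ≤ n, and 0 from then on. The resulting sums
-- over k break off at the integral part of n / b. Taking y = n / b as the variable and θ as a free
-- parameter puts all residues on one common variable, in which their polynomials can be subtracted.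

ℚ-ring : ACR.AlmostCommutativeRing 0ℓ 0ℓ
ℚ-ring = ACR.fromCommutativeRing +-*-commutativeRing (λ x → dec⇒maybe (0ℚ ℚ.≟ x))

-- Rational arithmetic

toℚᵘ-fromℕ : ∀ n → toℚᵘ (fromℕ n) ℚᵘ.≃ ℚᵘ.mkℚᵘ (ℤ.+ n) 0
toℚᵘ-fromℕ n = toℚᵘ-fromℚᵘ (ℚᵘ.mkℚᵘ (ℤ.+ n) 0)

fromℕ-homo-+ : ∀ m n → fromℕ (m ℕ.+ n) ≡ fromℕ m + fromℕ n
fromℕ-homo-+ m n = toℚᵘ-injective (begin
  toℚᵘ (fromℕ (m ℕ.+ n))                   ≈⟨ toℚᵘ-fromℕ (m ℕ.+ n) ⟩
  ℚᵘ.mkℚᵘ (ℤ.+ (m ℕ.+ n)) 0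
    ≈⟨ ℚᵘ.*≡* (cong (ℤ._* ℤ.+ 1) (sym (cong₂ ℤ._+_ (ℤ.*-identityʳ (ℤ.+ m)) (ℤ.*-identityʳ (ℤ.+ n))))) ⟩
  ℚᵘ.mkℚᵘ (ℤ.+ m) 0 ℚᵘ.+ ℚᵘ.mkℚᵘ (ℤ.+ n) 0 ≈⟨ ℚᵘ.+-cong (toℚᵘ-fromℕ m) (toℚᵘ-fromℕ n) ⟨
  toℚᵘ (fromℕ m) ℚᵘ.+ toℚᵘ (fromℕ n)   ≈⟨ toℚᵘ-homo-+ (fromℕ m) (fromℕ n) ⟨
  toℚᵘ (fromℕ m + fromℕ n)             ∎)
  where open ℚᵘ.≃-Reasoning

fromℕ-homo-* : ∀ m n → fromℕ (m ℕ.* n) ≡ fromℕ m * fromℕ n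
fromℕ-homo-* m n = toℚᵘ-injective (begin
  toℚᵘ (fromℕ (m ℕ.* n))               ≈⟨ toℚᵘ-fromℕ (m ℕ.* n) ⟩
  ℚᵘ.mkℚᵘ (ℤ.+ (m ℕ.* n)) 0              ≈⟨ ℚᵘ.*≡* (cong (ℤ._* ℤ.+ 1) (ℤ.pos-* m n)) ⟩
  ℚᵘ.mkℚᵘ (ℤ.+ m) 0 ℚᵘ.* ℚᵘ.mkℚᵘ (ℤ.+ n) 0 ≈⟨ ℚᵘ.*-cong (toℚᵘ-fromℕ m) (toℚᵘ-fromℕ n) ⟨
  toℚᵘ (fromℕ m) ℚᵘ.* toℚᵘ (fromℕ n)   ≈⟨ toℚᵘ-homo-* (fromℕ m) (fromℕ n) ⟨
  toℚᵘ (fromℕ m * fromℕ n)             ∎)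
  where open ℚᵘ.≃-Reasoning

fromℕ-suc : ∀ n → fromℕ (suc n) ≡ 1ℚ + fromℕ n
fromℕ-suc = fromℕ-homo-+ 1

fromℕ-injective : ∀ {m n} → fromℕ m ≡ fromℕ n → m ≡ n
fromℕ-injective {m} {n} eq = ℤ.+-injective (ℤ.*-cancelʳ-≡ (ℤ.+ m) (ℤ.+ n) (ℤ.+ 1) (ℚᵘ.drop-*≡* (begin
  ℚᵘ.mkℚᵘ (ℤ.+ m) 0  ≈⟨ toℚᵘ-fromℕ m ⟨
  toℚᵘ (fromℕ m)   ≡⟨ cong toℚᵘ eq ⟩
  toℚᵘ (fromℕ n)   ≈⟨ toℚᵘ-fromℕ n ⟩
  ℚᵘ.mkℚᵘ (ℤ.+ n) 0  ∎)))
  where open ℚᵘ.≃-Reasoning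

fromℕ-mono-< : ∀ {m n} → m ℕ.< n → fromℕ m ℚ.< fromℕ n
fromℕ-mono-< {m} {n} m<n = toℚᵘ-cancel-< (begin-strict
  toℚᵘ (fromℕ m)   ≃⟨ toℚᵘ-fromℕ m ⟩
  ℚᵘ.mkℚᵘ (ℤ.+ m) 0  <⟨ ℚᵘ.*<* (ℤ.*-monoʳ-<-pos (ℤ.+ 1) (ℤ.+<+ m<n)) ⟩
  ℚᵘ.mkℚᵘ (ℤ.+ n) 0  ≃⟨ toℚᵘ-fromℕ n ⟨
  toℚᵘ (fromℕ n)   ∎)
  where open ℚᵘ.≤-Reasoning

abstract
  -- Abstract, so that 1 / n stays a symbol: all that matters is its product with `fromℕ n` and its
  -- sign.
  recip : ∀ n → .{{ℕ.NonZero n}} → ℚ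
  recip n = ℤ.+ 1 / n

  fromℕ-*-recip : ∀ n → .{{_ : ℕ.NonZero n}} → fromℕ n * recip n ≡ 1ℚ
  fromℕ-*-recip n@(suc n-1) = toℚᵘ-injective (begin
    toℚᵘ (fromℕ n * recip n)                  ≈⟨ toℚᵘ-homo-* (fromℕ n) (recip n) ⟩
    toℚᵘ (fromℕ n) ℚᵘ.* toℚᵘ (recip n)
      ≈⟨ ℚᵘ.*-cong (toℚᵘ-fromℕ n) (toℚᵘ-fromℚᵘ (ℚᵘ.mkℚᵘ (ℤ.+ 1) n-1)) ⟩
    ℚᵘ.mkℚᵘ (ℤ.+ n) 0 ℚᵘ.* ℚᵘ.mkℚᵘ (ℤ.+ 1) n-1
      ≈⟨ ℚᵘ.*≡* (trans (cong (ℤ._* ℤ.+ 1) (ℤ.*-identityʳ (ℤ.+ n)))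
           (trans (ℤ.*-identityʳ (ℤ.+ n)) (sym (trans (ℤ.*-identityˡ _) (ℤ.*-identityˡ (ℤ.+ n)))))) ⟩
    ℚᵘ.1ℚᵘ                                    ∎)
    where open ℚᵘ.≃-Reasoning

  recip-positive : ∀ n → .{{_ : ℕ.NonZero n}} → 0ℚ ℚ.< recip n
  recip-positive n@(suc n-1) = toℚᵘ-cancel-< (begin-strict
    ℚᵘ.0ℚᵘ               <⟨ ℚᵘ.positive⁻¹ (ℚᵘ.mkℚᵘ (ℤ.+ 1) n-1) ⟩
    ℚᵘ.mkℚᵘ (ℤ.+ 1) n-1    ≃⟨ toℚᵘ-fromℚᵘ (ℚᵘ.mkℚᵘ (ℤ.+ 1) n-1) ⟨
    toℚᵘ (recip n)       ∎)
    where open ℚᵘ.≤-Reasoning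

*-positive : ∀ {p q} → 0ℚ ℚ.< p → 0ℚ ℚ.< q → 0ℚ ℚ.< p * q
*-positive {p} {q} 0<p 0<q =
  positive⁻¹ (p * q) {{pos*pos⇒pos p {{positive 0<p}} q {{positive 0<q}}}}

infixr 8 _^_

_^_ : ℚ → ℕ → ℚ
x ^ zero  = 1ℚ
x ^ suc n = x * x ^ n

0^ : ∀ m → 0ℚ ^ suc m ≡ 0ℚ
0^ m = *-zeroˡ (0ℚ ^ m)

1^ : ∀ m → 1ℚ ^ m ≡ 1ℚ
1^ zero    = refl
1^ (suc m) = trans (*-identityˡ (1ℚ ^ m)) (1^ m)

-- Polynomial functions

-- f is a polynomial function of degree at most d whose coefficient in degree
-- d is κ; κ may vanish.
Lead : ℕ → ℚ → (ℚ → ℚ) → Set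
Lead zero    κ f = ∀ x → f x ≡ κ
Lead (suc d) κ f = ∃ λ a → ∃ λ g → Lead d κ g × (∀ x → f x ≡ a + x * g x)

Deg≤ : ℕ → (ℚ → ℚ) → Set
Deg≤ d f = ∃ λ κ → Lead d κ f

PositiveLead : ℕ → (ℚ → ℚ) → Set
PositiveLead d f = ∃ λ κ → 0ℚ ℚ.< κ × Lead d κ f

lead-cast : ∀ {d e} κ f → d ≡ e → Lead d κ f → Lead e κ f
lead-cast _ _ refl l = l

lead-ext : ∀ d {κ κ′ f g} → κ ≡ κ′ → (∀ x → f x ≡ g x) → Lead d κ f → Lead d κ′ g
lead-ext zero    refl f≗g l                 = λ x → trans (sym (f≗g x)) (l x)
lead-ext (suc d) refl f≗g (a , h , l , f≡) = a , h , l , λ x → trans (sym (f≗g x)) (f≡ x)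

lead-zero : ∀ d {f} → (∀ x → f x ≡ 0ℚ) → Lead d 0ℚ f
lead-zero zero    f≡0 = f≡0
lead-zero (suc d) f≡0 =
  0ℚ , (λ _ → 0ℚ) , lead-zero d (λ _ → refl) , λ x → trans (f≡0 x) (lemma x)
  where
  lemma : ∀ x → 0ℚ ≡ 0ℚ + x * 0ℚ
  lemma = solve-∀ ℚ-ring

lead-raise : ∀ d {κ f} → Lead d κ f → Lead (suc d) 0ℚ f
lead-raise zero {κ} l = κ , (λ _ → 0ℚ) , (λ _ → refl) , λ x → trans (l x) (lemma κ x)
  where
  lemma : ∀ κ x → κ ≡ κ + x * 0ℚ
  lemma = solve-∀ ℚ-ring
lead-raise (suc d) (a , g , l , f≡) = a , g , lead-raise d l , f≡

lead-raise* : ∀ e d {κ f} → Lead d κ f → Lead (suc (e ℕ.+ d)) 0ℚ f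
lead-raise* zero    d l = lead-raise d l
lead-raise* (suc e) d l = lead-raise _ (lead-raise* e d l)

lead-lower : ∀ d {f} → Lead (suc d) 0ℚ f → Deg≤ d f
lead-lower zero {f} (a , g , l , f≡) = a , λ x → begin
  f x           ≡⟨ f≡ x ⟩
  a + x * g x   ≡⟨ cong (λ z → a + x * z) (l x) ⟩
  a + x * 0ℚ    ≡⟨ lemma a x ⟩
  a             ∎
  where
  open ≡-Reasoning
  lemma : ∀ a x → a + x * 0ℚ ≡ a
  lemma = solve-∀ ℚ-ring
lead-lower (suc d) (a , g , l , f≡) with lead-lower d l
... | κ , l′ = κ , a , g , l′ , f≡

lead-+ : ∀ d {κ κ′ f g} → Lead d κ f → Lead d κ′ g → Lead d (κ + κ′) (λ x → f x + g x)
lead-+ zero    l l′ x = cong₂ _+_ (l x) (l′ x)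
lead-+ (suc d) (a , f′ , l , f≡) (b , g′ , l′ , g≡) =
  a + b , (λ x → f′ x + g′ x) , lead-+ d l l′ ,
  λ x → trans (cong₂ _+_ (f≡ x) (g≡ x)) (lemma a b x (f′ x) (g′ x))
  where
  lemma : ∀ a b x u v → (a + x * u) + (b + x * v) ≡ (a + b) + x * (u + v)
  lemma = solve-∀ ℚ-ring

lead-scale : ∀ d c {κ f} → Lead d κ f → Lead d (c * κ) (λ x → c * f x)
lead-scale zero    c l x = cong (c *_) (l x)
lead-scale (suc d) c (a , f′ , l , f≡) =
  c * a , (λ x → c * f′ x) , lead-scale d c l ,
  λ x → trans (cong (c *_) (f≡ x)) (lemma c a x (f′ x))
  where
  lemma : ∀ c a x u → c * (a + x * u) ≡ c * a + x * (c * u)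
  lemma = solve-∀ ℚ-ring

lead-minus : ∀ d {κ κ′ f g} → Lead d κ f → Lead d κ′ g → Lead d (κ - κ′) (λ x → f x - g x)
lead-minus d {κ} {κ′} {f} {g} l l′ =
  lead-ext d (lemma κ κ′) (λ x → lemma (f x) (g x)) (lead-+ d l (lead-scale d (- 1ℚ) l′))
  where
  lemma : ∀ u v → u + - 1ℚ * v ≡ u - v
  lemma = solve-∀ ℚ-ring

lead-x* : ∀ d {κ f} → Lead d κ f → Lead (suc d) κ (λ x → x * f x)
lead-x* d {f = f} l = 0ℚ , f , l , λ x → sym (+-identityˡ (x * f x))

lead-^ : ∀ d → Lead d 1ℚ (_^ d)
lead-^ zero    = λ _ → refl
lead-^ (suc d) = lead-x* d (lead-^ d)

lead-* : ∀ d e {κ κ′ f g} → Lead d κ f → Lead e κ′ g → Lead (d ℕ.+ e) (κ * κ′) (λ x → f x * g x)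
lead-* zero e {κ} {g = g} l l′ =
  lead-ext e refl (λ x → cong (_* g x) (sym (l x))) (lead-scale e κ l′)
lead-* (suc d) e {κ} {κ′} {f} {g} (a , f′ , l , f≡) l′ =
  lead-ext (suc d ℕ.+ e) (+-identityˡ (κ * κ′)) pointwise
    (lead-+ (suc d ℕ.+ e) (lead-raise* d e (lead-scale e a l′)) (lead-x* (d ℕ.+ e) (lead-* d e l l′)))
  where
  lemma : ∀ a x u v → a * v + x * (u * v) ≡ (a + x * u) * v
  lemma = solve-∀ ℚ-ring
  pointwise : ∀ x → a * g x + x * (f′ x * g x) ≡ f x * g x
  pointwise x = trans (lemma a x (f′ x) (g x)) (cong (_* g x) (sym (f≡ x)))

lead-shift : ∀ d c {κ f} → Lead d κ f → Lead d κ (λ x → f (x + c))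
lead-shift zero    c l x = l (x + c)
lead-shift (suc d) c {κ} {f} (a , g , l , f≡) =
  lead-ext (suc d) (lemma₁ κ) pointwise
    (lead-+ (suc d)
      (lead-+ (suc d)
        (lead-cast 0ℚ (λ _ → a) (cong suc (ℕ.+-identityʳ d)) (lead-raise* d 0 (λ _ → refl)))
        (lead-raise d (lead-scale d c l′)))
      (lead-x* d l′))
  where
  l′ = lead-shift d c l
  lemma₁ : ∀ κ → (0ℚ + 0ℚ) + κ ≡ κ
  lemma₁ = solve-∀ ℚ-ring
  lemma₂ : ∀ a c x u → (a + c * u) + x * u ≡ a + (x + c) * u
  lemma₂ = solve-∀ ℚ-ring
  pointwise : ∀ x → (a + c * g (x + c)) + x * g (x + c) ≡ f (x + c)
  pointwise x = trans (lemma₂ a c x (g (x + c))) (sym (f≡ (x + c)))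

lead-dilate : ∀ d c {κ f} → Lead d κ f → Deg≤ d (λ x → f (x * c))
lead-dilate zero    c {κ} l = κ , λ x → l (x * c)
lead-dilate (suc d) c {f = f} (a , g , l , f≡) with lead-dilate d c l
... | κ′ , l′ = c * κ′ , a , (λ x → c * g (x * c)) , lead-scale d c l′ ,
  λ x → trans (f≡ (x * c)) (lemma a c x (g (x * c)))
  where
  lemma : ∀ a c x u → a + (x * c) * u ≡ a + x * (c * u)
  lemma = solve-∀ ℚ-ring

-- Discrete Leibniz rule: the difference of `a + x * g x` is `x * (g (x + 1ℚ) - g x) + g (x + 1ℚ)`,
-- so every factor x adds one more κ to the leading coefficient.
lead-Δ : ∀ d {κ f} → Lead (suc d) κ f → Lead d (fromℕ (suc d) * κ) (λ x → f (x + 1ℚ) - f x)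
lead-Δ zero {κ} {f} (a , g , l , f≡) x = begin
  f (x + 1ℚ) - f x                                ≡⟨ cong₂ _-_ (f≡ (x + 1ℚ)) (f≡ x) ⟩
  (a + (x + 1ℚ) * g (x + 1ℚ)) - (a + x * g x)
    ≡⟨ cong₂ (λ u v → (a + (x + 1ℚ) * u) - (a + x * v)) (l (x + 1ℚ)) (l x) ⟩
  (a + (x + 1ℚ) * κ) - (a + x * κ)                ≡⟨ lemma a x κ ⟩
  1ℚ * κ                                          ∎
  where
  open ≡-Reasoning
  lemma : ∀ a x κ → (a + (x + 1ℚ) * κ) - (a + x * κ) ≡ 1ℚ * κ
  lemma = solve-∀ ℚ-ring
lead-Δ (suc d) {κ} {f} (a , g , l , f≡) =
  lead-ext (suc d) coefficient pointwise
    (lead-+ (suc d) (lead-x* d (lead-Δ d l)) (lead-shift (suc d) 1ℚ l))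
  where
  lemma₁ : ∀ κ n → n * κ + κ ≡ (1ℚ + n) * κ
  lemma₁ = solve-∀ ℚ-ring
  coefficient : fromℕ (suc d) * κ + κ ≡ fromℕ (suc (suc d)) * κ
  coefficient = trans (lemma₁ κ (fromℕ (suc d))) (cong (_* κ) (sym (fromℕ-suc (suc d))))
  lemma₂ : ∀ a x u v → x * (v - u) + v ≡ (a + (x + 1ℚ) * v) - (a + x * u)
  lemma₂ = solve-∀ ℚ-ring
  pointwise : ∀ x → x * (g (x + 1ℚ) - g x) + g (x + 1ℚ) ≡ f (x + 1ℚ) - f x
  pointwise x = trans (lemma₂ a x (g x) (g (x + 1ℚ))) (sym (cong₂ _-_ (f≡ (x + 1ℚ)) (f≡ x)))

-- The difference of the monomial `H` agrees with f in the leading term, and the remainder has lower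
-- degree. The value 0 at 0 makes G a sum that starts at 0. The coefficient η is given by an
-- equation because `moment-difference-lead₁` uses it in this form.
antidifference : ∀ d {γ f} → Lead d γ f → ∃₂ λ G η →
  Lead (suc d) η G × fromℕ (suc d) * η ≡ γ × G 0ℚ ≡ 0ℚ × (∀ x → G (x + 1ℚ) - G x ≡ f x)
antidifference zero {γ} {f} l =
  (λ x → x * f x) , γ , lead-x* zero l , *-identityˡ γ , *-zeroˡ (f 0ℚ) ,
  λ x → trans (cong₂ (λ u v → (x + 1ℚ) * u - x * v) (trans (l (x + 1ℚ)) (sym (l x))) refl) (lemma x (f x))
  where
  lemma : ∀ x u → (x + 1ℚ) * u - x * u ≡ u
  lemma = solve-∀ ℚ-ring
antidifference (suc d) {γ} {f} l = extend (antidifference d (proj₂ remainder))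
  where
  n = fromℕ (suc (suc d))
  η = recip (suc (suc d)) * γ
  H : ℚ → ℚ
  H x = η * x ^ suc (suc d)
  H-lead : Lead (suc (suc d)) η H
  H-lead = lead-ext (suc (suc d)) (*-identityʳ η) (λ _ → refl)
    (lead-scale (suc (suc d)) η (lead-^ (suc (suc d))))
  nη≡γ : n * η ≡ γ
  nη≡γ = trans (sym (ℚ.*-assoc n _ γ))
    (trans (cong (_* γ) (fromℕ-*-recip (suc (suc d)))) (*-identityˡ γ))
  H0≡0 : H 0ℚ ≡ 0ℚ
  H0≡0 = trans (cong (η *_) (*-zeroˡ (0ℚ ^ suc d))) (*-zeroʳ η)
  rest : ℚ → ℚ
  rest x = f x - (H (x + 1ℚ) - H x)
  remainder : Deg≤ d rest
  remainder = lead-lower d (lead-ext (suc d) (trans (cong (λ z → γ - z) nη≡γ) (+-inverseʳ γ))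
    (λ _ → refl) (lead-minus (suc d) l (lead-Δ (suc d) H-lead)))
  lemma₁ : ∀ g h g′ h′ → (g + h) - (g′ + h′) ≡ (g - g′) + (h - h′)
  lemma₁ = solve-∀ ℚ-ring
  lemma₂ : ∀ u v → (u - v) + v ≡ u
  lemma₂ = solve-∀ ℚ-ring
  extend : (∃₂ λ G η′ → Lead (suc d) η′ G × fromℕ (suc d) * η′ ≡ proj₁ remainder ×
              G 0ℚ ≡ 0ℚ × (∀ x → G (x + 1ℚ) - G x ≡ rest x)) →
           ∃₂ λ G η′ → Lead (suc (suc d)) η′ G × n * η′ ≡ γ ×
              G 0ℚ ≡ 0ℚ × (∀ x → G (x + 1ℚ) - G x ≡ f x)
  extend (G , _ , G-lead , _ , G0≡0 , ΔG) =
    (λ x → G x + H x) , η ,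
    lead-ext (suc (suc d)) (+-identityˡ η) (λ _ → refl)
      (lead-+ (suc (suc d)) (lead-raise (suc d) G-lead) H-lead) ,
    nη≡γ ,
    cong₂ _+_ G0≡0 H0≡0 ,
    λ x → trans (lemma₁ (G (x + 1ℚ)) (H (x + 1ℚ)) (G x) (H x))
                (trans (cong (_+ (H (x + 1ℚ) - H x)) (ΔG x)) (lemma₂ (f x) (H (x + 1ℚ) - H x)))

-- Synthetic division. The quotient keeps the leading coefficient κ, so `vanishing` can pass κ down
-- to degree 0.
factor : ∀ d α {κ f} → Lead (suc d) κ f →
  ∃ λ g → Lead d κ g × (∀ x → f x - f α ≡ (x - α) * g x)
factor zero α {κ} {f} (a , g , l , f≡) = g , l , λ x → begin
  f x - f α                         ≡⟨ cong₂ _-_ (f≡ x) (f≡ α) ⟩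
  (a + x * g x) - (a + α * g α)     ≡⟨ cong (λ u → (a + x * g x) - (a + α * u)) (trans (l α) (sym (l x))) ⟩
  (a + x * g x) - (a + α * g x)     ≡⟨ lemma a x α (g x) ⟩
  (x - α) * g x                     ∎
  where
  open ≡-Reasoning
  lemma : ∀ a x α u → (a + x * u) - (a + α * u) ≡ (x - α) * u
  lemma = solve-∀ ℚ-ring
factor (suc d) α {κ} {f} (a , g , l , f≡) with factor d α l
... | h , l′ , g-gα =
  (λ x → g x + α * h x) ,
  lead-ext (suc d) (+-identityʳ κ) (λ _ → refl) (lead-+ (suc d) l (lead-raise d (lead-scale d α l′))) ,
  λ x → begin
    f x - f α                               ≡⟨ cong₂ _-_ (f≡ x) (f≡ α) ⟩
    (a + x * g x) - (a + α * g α)           ≡⟨ lemma₁ a x α (g x) (g α) ⟩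
    (x - α) * g x + α * (g x - g α)         ≡⟨ cong (λ u → (x - α) * g x + α * u) (g-gα x) ⟩
    (x - α) * g x + α * ((x - α) * h x)     ≡⟨ lemma₂ (x - α) α (g x) (h x) ⟩
    (x - α) * (g x + α * h x)               ∎
  where
  open ≡-Reasoning
  lemma₁ : ∀ a x α u v → (a + x * u) - (a + α * v) ≡ (x - α) * u + α * (u - v)
  lemma₁ = solve-∀ ℚ-ring
  lemma₂ : ∀ y α u v → y * u + α * (y * v) ≡ y * (u + α * v)
  lemma₂ = solve-∀ ℚ-ring

*-zero-product : ∀ p q → p ≢ 0ℚ → p * q ≡ 0ℚ → q ≡ 0ℚ
*-zero-product p q p≢0 pq≡0 =
  *-cancelˡ-≡ {{≢-nonZero p≢0}} (trans pq≡0 (sym (*-zeroʳ p)))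
  where
  *-cancelˡ-≡ : ∀ {r s} → .{{_ : ℚ.NonZero p}} → p * r ≡ p * s → r ≡ s
  *-cancelˡ-≡ {r} {s} eq = begin
    r                 ≡⟨ *-identityˡ r ⟨
    1ℚ * r            ≡⟨ cong (_* r) (*-inverseˡ p) ⟨
    (1/ p) * p * r    ≡⟨ ℚ.*-assoc (1/ p) p r ⟩
    (1/ p) * (p * r)  ≡⟨ cong ((1/ p) *_) eq ⟩
    (1/ p) * (p * s)  ≡⟨ ℚ.*-assoc (1/ p) p s ⟨
    (1/ p) * p * s    ≡⟨ cong (_* s) (*-inverseˡ p) ⟩
    1ℚ * s            ≡⟨ *-identityˡ s ⟩
    s                 ∎
    where open ≡-Reasoning

-- Splitting off the root `s 0` leaves a quotient that vanishes along `s ∘ suc`. An infinite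
-- sequence of roots, rather than `d + 1` of them, is a hypothesis that reproduces itself under this
-- step.
vanishing : ∀ d {κ f} (s : ℕ → ℚ) → (∀ {i j} → s i ≡ s j → i ≡ j) →
  Lead d κ f → (∀ i → f (s i) ≡ 0ℚ) → κ ≡ 0ℚ × (∀ x → f x ≡ 0ℚ)
vanishing zero    s _     l fs≡0 = κ≡0 , λ x → trans (l x) κ≡0
  where κ≡0 = trans (sym (l (s 0))) (fs≡0 0)
vanishing (suc d) {f = f} s s-inj l fs≡0 with factor d (s 0) l
... | g , lg , f-f = proj₁ IH , λ x → begin
    f x               ≡⟨ f≡ x ⟩
    (x - s 0) * g x   ≡⟨ cong ((x - s 0) *_) (proj₂ IH x) ⟩
    (x - s 0) * 0ℚ    ≡⟨ *-zeroʳ (x - s 0) ⟩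
    0ℚ                ∎
  where
  open ≡-Reasoning
  lemma₁ : ∀ u → u ≡ u - 0ℚ
  lemma₁ = solve-∀ ℚ-ring
  lemma₂ : ∀ u v → u ≡ (u - v) + v
  lemma₂ = solve-∀ ℚ-ring
  f≡ : ∀ x → f x ≡ (x - s 0) * g x
  f≡ x = trans (trans (lemma₁ (f x)) (cong (λ u → f x - u) (sym (fs≡0 0)))) (f-f x)
  apart : ∀ i → s (suc i) - s 0 ≢ 0ℚ
  apart i eq = ℕ.1+n≢0 (s-inj (trans (lemma₂ (s (suc i)) (s 0))
    (trans (cong (_+ s 0) eq) (+-identityˡ (s 0)))))
  IH = vanishing d (s ∘ suc) (λ eq → ℕ.suc-injective (s-inj eq)) lg
    (λ i → *-zero-product _ _ (apart i) (trans (sym (f≡ (s (suc i)))) (fs≡0 (suc i))))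

agreement : ∀ {d e f g} → Deg≤ d f → Deg≤ e g → (s : ℕ → ℚ) → (∀ {i j} → s i ≡ s j → i ≡ j) →
  (∀ i → f (s i) ≡ g (s i)) → ∀ x → f x ≡ g x
agreement {d} {e} {f} {g} (_ , lf) (_ , lg) s s-inj eq x = trans (lemma (f x) (g x))
  (trans (cong (λ z → z + g x) (proj₂ (vanishing (suc (e ℕ.+ d)) s s-inj
    (lead-minus (suc (e ℕ.+ d)) (lead-raise* e d lf)
      (lead-cast 0ℚ g (cong suc (ℕ.+-comm d e)) (lead-raise* d e lg)))
    (λ i → trans (cong (λ z → z - g (s i)) (eq i)) (ℚ.+-inverseʳ (g (s i))))) x))
    (+-identityˡ (g x)))
  where
  lemma : ∀ u v → u ≡ u - v + v
  lemma = solve-∀ ℚ-ring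

eval-lead : ∀ f → ∃ λ d → Deg≤ d (eval f)
eval-lead []      = 0 , 0ℚ , λ _ → refl
eval-lead (a ∷ f) with eval-lead f
... | d , κ , l = suc d , κ , a , eval f , l , λ _ → refl

lead⇒polynomial : ∀ d {κ f} → Lead d κ f → Σ Polynomial λ g → ∀ x → f x ≡ eval g x
lead⇒polynomial zero {κ} l = (κ ∷ []) , λ x → trans (l x) (lemma κ x)
  where
  lemma : ∀ κ x → κ ≡ κ + x * 0ℚ
  lemma = solve-∀ ℚ-ring
lead⇒polynomial (suc d) (a , g , l , f≡) with lead⇒polynomial d l
... | p , g≡ = (a ∷ p) , λ x → trans (f≡ x) (cong (λ u → a + x * u) (g≡ x))

-- Interpolation and moments

interpolate : ℚ → (ℚ → ℚ) → ℚ → ℚ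
interpolate θ H x = (1ℚ - θ) * H x + θ * H (x + 1ℚ)

-- When θ is the fractional part of y, `y - θ` and `y - θ + 1ℚ` are the integers next to y, and this
-- is the interpolation error at y. With θ kept as a separate parameter it is a polynomial function
-- of y.
gap : ℚ → (ℚ → ℚ) → ℚ → ℚ
gap θ H y = interpolate θ H (y - θ) - H y

interpolate-lead : ∀ d θ {κ H} → Lead d κ H → Deg≤ d (λ y → interpolate θ H (y - θ))
interpolate-lead d θ l = _ ,
  lead-shift d (- θ) (lead-+ d (lead-scale d (1ℚ - θ) l) (lead-scale d θ (lead-shift d 1ℚ l)))

-- Let X take the two nodes as values, with probabilities `1ℚ - θ` and θ, so that its mean is y. The
-- mean of `X * K X` is y times the mean of `K X` plus their covariance, which is `θ * (1ℚ - θ)`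
-- times the increment of K.
gap-step : ∀ θ a {H K : ℚ → ℚ} → (∀ x → H x ≡ a + x * K x) → ∀ y →
  y * gap θ K y + θ * (1ℚ - θ) * (K (y - θ + 1ℚ) - K (y - θ)) ≡ gap θ H y
gap-step θ a {H} {K} H≡ y = begin
  y * gap θ K y + θ * (1ℚ - θ) * (k₁ - k₀)
    ≡⟨ lemma θ a y k₀ k₁ (K y) ⟩
  (1ℚ - θ) * (a + (y - θ) * k₀) + θ * (a + (y - θ + 1ℚ) * k₁) - (a + y * K y)
    ≡⟨ cong₂ _-_ (cong₂ (λ s t → (1ℚ - θ) * s + θ * t) (H≡ (y - θ)) (H≡ (y - θ + 1ℚ))) (H≡ y) ⟨
  gap θ H y ∎
  where
  open ≡-Reasoning
  k₀ = K (y - θ)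
  k₁ = K (y - θ + 1ℚ)
  lemma : ∀ θ a y u v k →
    y * ((1ℚ - θ) * u + θ * v - k) + θ * (1ℚ - θ) * (v - u) ≡
    (1ℚ - θ) * (a + (y - θ) * u) + θ * (a + (y - θ + 1ℚ) * v) - (a + y * k)
  lemma = solve-∀ ℚ-ring

gap-constant : ∀ θ {κ K} → Lead 0 κ K → ∀ y → gap θ K y ≡ 0ℚ
gap-constant θ {κ} {K} l y =
  trans (cong₂ _-_ (cong₂ (λ s t → (1ℚ - θ) * s + θ * t) (l (y - θ)) (l (y - θ + 1ℚ))) (l y)) (lemma θ κ)
  where
  lemma : ∀ θ κ → (1ℚ - θ) * κ + θ * κ - κ ≡ 0ℚ
  lemma = solve-∀ ℚ-ring

gap-linear : ∀ θ {κ K} → Lead 1 κ K → ∀ y → gap θ K y ≡ 0ℚ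
gap-linear θ {κ} {K} (a , g , l , K≡) y = begin
  gap θ K y                                                          ≡⟨ gap-step θ a K≡ y ⟨
  y * gap θ g y + θ * (1ℚ - θ) * (g (y - θ + 1ℚ) - g (y - θ))
    ≡⟨ cong₂ (λ s t → y * s + θ * (1ℚ - θ) * t) (gap-constant θ l y) (cong₂ _-_ (l (y - θ + 1ℚ)) (l (y - θ))) ⟩
  y * 0ℚ + θ * (1ℚ - θ) * (κ - κ)                                    ≡⟨ lemma θ y κ ⟩
  0ℚ ∎
  where
  open ≡-Reasoning
  lemma : ∀ θ y κ → y * 0ℚ + θ * (1ℚ - θ) * (κ - κ) ≡ 0ℚ
  lemma = solve-∀ ℚ-ring

-- The number (d + 1)(d + 2) / 2, which is half the coefficient of the second derivative of x^(d +
-- 2).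
triangular : ℕ → ℚ
triangular zero    = 1ℚ
triangular (suc d) = triangular d + fromℕ (suc (suc d))

-- To leading order the interpolation error is θ (1 - θ) H″ / 2.
gap-lead : ∀ d θ {η H} → Lead (suc (suc d)) η H →
  Lead d (θ * (1ℚ - θ) * triangular d * η) (gap θ H)
gap-lead zero θ {η} {H} (a , K , l , H≡) =
  lead-ext 0 (lemma₁ θ η) (gap-step θ a H≡)
    (lead-+ 0 (λ y → trans (cong (y *_) (gap-linear θ l y)) (*-zeroʳ y))
              (lead-scale 0 (θ * (1ℚ - θ)) (lead-shift 0 (- θ) (lead-Δ 0 l))))
  where
  lemma₁ : ∀ θ η → 0ℚ + θ * (1ℚ - θ) * (1ℚ * η) ≡ θ * (1ℚ - θ) * 1ℚ * η
  lemma₁ = solve-∀ ℚ-ring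
gap-lead (suc d) θ {η} {H} (a , K , l , H≡) =
  lead-ext (suc d) (lemma₁ θ (triangular d) (fromℕ (suc (suc d))) η) (gap-step θ a H≡)
    (lead-+ (suc d) (lead-x* d (gap-lead d θ l))
                    (lead-scale (suc d) (θ * (1ℚ - θ)) (lead-shift (suc d) (- θ) (lead-Δ (suc d) l))))
  where
  lemma₁ : ∀ θ t n η →
    θ * (1ℚ - θ) * t * η + θ * (1ℚ - θ) * (n * η) ≡ θ * (1ℚ - θ) * (t + n) * η
  lemma₁ = solve-∀ ℚ-ring

-- A square with s later squares on its line contributes (1 + s)^m - s^m to the moment of index m -
-- 1. This is the increment of that contribution from s = x to s = x + 1, hence the weight of a pair
-- of squares x + 1 moves apart.
second-difference : ℕ → ℚ → ℚ
second-difference m x = (1ℚ + (1ℚ + x)) ^ m - (1ℚ + x) ^ m - ((1ℚ + x) ^ m - x ^ m)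

-- At a natural number n this is the sum of j^m over j < n.
powerSum : ℕ → ℚ → ℚ
powerSum m = proj₁ (antidifference m (lead-^ m))

powerSum-0 : ∀ m → powerSum m 0ℚ ≡ 0ℚ
powerSum-0 m with antidifference m (lead-^ m)
... | _ , _ , _ , _ , eq , _ = eq

powerSum-Δ : ∀ m x → powerSum m (x + 1ℚ) - powerSum m x ≡ x ^ m
powerSum-Δ m with antidifference m (lead-^ m)
... | _ , _ , _ , _ , _ , eq = eq

powerSum-lead : ∀ m → ∃ λ η → Lead (suc m) η (powerSum m) × fromℕ (suc m) * η ≡ 1ℚ
powerSum-lead m with antidifference m (lead-^ m)
... | _ , η , l , eq , _ = η , l , eq

-- With w (t + 1) = second-difference m t, these have second differences
-- w (t + 1) and (t + 1) w (t + 1), and they vanish at 0 and 1.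
summed-w summed-kw : ℕ → ℚ → ℚ
summed-w  m t = t ^ m - t
summed-kw m t = t ^ suc m - t ^ m - (1ℚ + 1ℚ) * powerSum m t

module _ (a b : ℚ) where

  -- For n = b y and θ the fractional part of y, this is Σ (size of the line of z)^i
  -- over the squares z of the n × n board.
  moment : ℚ → ℕ → ℚ → ℚ
  moment θ zero    y = b * y * (b * y)
  moment θ (suc i) y = b * y * (b * y) +
    b * (b * y * interpolate θ (summed-w (suc (suc i))) (y - θ)
         - a * interpolate θ (summed-kw (suc (suc i))) (y - θ))

  summed-w-lead : ∀ i → Lead (suc (suc i)) 1ℚ (summed-w (suc (suc i)))
  summed-w-lead i = lead-ext (suc (suc i)) refl (λ t → cong (λ z → t ^ suc (suc i) - z) (*-identityʳ t))
    (lead-minus (suc (suc i)) (lead-^ (suc (suc i)))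
      (subst (λ n → Lead (suc n) 0ℚ (_^ 1)) (ℕ.+-comm i 1) (lead-raise* i 1 (lead-^ 1))))

  summed-kw-lead : ∀ m → Lead (suc m) (1ℚ - (1ℚ + 1ℚ) * proj₁ (powerSum-lead m)) (summed-kw m)
  summed-kw-lead m = lead-ext (suc m) (lemma ((1ℚ + 1ℚ) * proj₁ (powerSum-lead m))) (λ _ → refl)
    (lead-minus (suc m) (lead-minus (suc m) (lead-^ (suc m)) (lead-raise m (lead-^ m)))
      (lead-scale (suc m) (1ℚ + 1ℚ) (proj₁ (proj₂ (powerSum-lead m)))))
    where
    lemma : ∀ z → 1ℚ - 0ℚ - z ≡ 1ℚ - z
    lemma = solve-∀ ℚ-ring

  square-lead : Lead 2 (b * b) (λ y → b * y * (b * y))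
  square-lead = lead-ext 2 (lemma₁ b) (lemma₂ b) (lead-scale 2 (b * b) (lead-^ 2))
    where
    lemma₁ : ∀ b → b * b * 1ℚ ≡ b * b
    lemma₁ = solve-∀ ℚ-ring
    lemma₂ : ∀ b y → b * b * (y * (y * 1ℚ)) ≡ b * y * (b * y)
    lemma₂ = solve-∀ ℚ-ring

  moment-deg : ∀ θ i → Deg≤ (suc (suc i)) (moment θ i)
  moment-deg θ zero    = _ , square-lead
  moment-deg θ (suc i) = _ ,
    lead-+ (suc (suc (suc i)))
      (subst (λ n → Lead (suc n) 0ℚ (λ y → b * y * (b * y))) (ℕ.+-comm i 2) (lead-raise* i 2 square-lead))
      (lead-scale (suc (suc (suc i))) b
        (lead-minus (suc (suc (suc i)))
          (lead-ext (suc (suc (suc i))) refl (λ y → sym (ℚ.*-assoc b y _))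
            (lead-scale (suc (suc (suc i))) b (lead-x* (suc (suc i))
              (proj₂ (interpolate-lead (suc (suc i)) θ (summed-w-lead i))))))
          (lead-scale (suc (suc (suc i))) a
            (proj₂ (interpolate-lead (suc (suc (suc i))) θ (summed-kw-lead (suc (suc i))))))))

  -- For θ = 0 the interpolant is evaluated at a node and returns H itself, so subtracting
  -- `moment 0ℚ` turns every interpolant into a gap.
  moment-difference : ∀ θ i y →
    b * (b * (y * gap θ (summed-w (suc (suc i))) y) - a * gap θ (summed-kw (suc (suc i))) y) ≡
    moment θ (suc i) y - moment 0ℚ (suc i) y
  moment-difference θ i y = trans
    (lemma₁ a b y (interpolate θ Hw (y - θ)) (Hw y) (interpolate θ Hkw (y - θ)) (Hkw y))
    (cong₂ (λ u v → moment θ (suc i) y - (b * y * (b * y) + b * (b * y * u - a * v)))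
      (sym (at-node Hw)) (sym (at-node Hkw)))
    where
    Hw  = summed-w (suc (suc i))
    Hkw = summed-kw (suc (suc i))
    lemma₁ : ∀ a b y u u′ v v′ →
      b * (b * (y * (u - u′)) - a * (v - v′)) ≡
      b * y * (b * y) + b * (b * y * u - a * v) - (b * y * (b * y) + b * (b * y * u′ - a * v′))
    lemma₁ = solve-∀ ℚ-ring
    lemma₂ : ∀ u v → (1ℚ - 0ℚ) * u + 0ℚ * v ≡ u
    lemma₂ = solve-∀ ℚ-ring
    lemma₃ : ∀ y → y - 0ℚ ≡ y
    lemma₃ = solve-∀ ℚ-ring
    at-node : ∀ H → interpolate 0ℚ H (y - 0ℚ) ≡ H y
    at-node H = trans (lemma₂ (H (y - 0ℚ)) (H (y - 0ℚ + 1ℚ))) (cong H (lemma₃ y))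

  -- A gap lies two degrees below its H. Hence the difference has degree at most `i + 1`, whereas
  -- the moment itself may have degree `i + 3`.
  moment-difference-lead : ∀ θ i → Lead (suc i)
    (b * (b * (θ * (1ℚ - θ) * triangular i * 1ℚ)
          - a * (θ * (1ℚ - θ) * triangular (suc i) * (1ℚ - (1ℚ + 1ℚ) * proj₁ (powerSum-lead (suc (suc i)))))))
    (λ y → moment θ (suc i) y - moment 0ℚ (suc i) y)
  moment-difference-lead θ i = lead-ext (suc i) refl (moment-difference θ i)
    (lead-scale (suc i) b
      (lead-minus (suc i)
        (lead-scale (suc i) b (lead-x* i (gap-lead i θ (summed-w-lead i))))
        (lead-scale (suc i) a (gap-lead (suc i) θ (summed-kw-lead (suc (suc i)))))))

  moment-difference-lead₁ : ∀ θ → Lead 1 (b * (b - a) * (θ * (1ℚ - θ)))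
    (λ y → moment θ 1 y - moment 0ℚ 1 y)
  moment-difference-lead₁ θ = lead-ext 1 coefficient (λ _ → refl) (moment-difference-lead θ 0)
    where
    η = proj₁ (powerSum-lead 2)
    -- Here η is 1/3, known through 3 η = 1. Writing 3 (1 - 2 η) as 1 + 2 (1 - 3 η) lets that
    -- equation be substituted, and the factor of a becomes 1.
    lemma : ∀ a b θ η →
      b * (b * (θ * (1ℚ - θ) * 1ℚ * 1ℚ) - a * (θ * (1ℚ - θ) * (1ℚ + (1ℚ + 1ℚ)) * (1ℚ - (1ℚ + 1ℚ) * η))) ≡
      b * (b - a * (1ℚ + (1ℚ + 1ℚ) * (1ℚ - (1ℚ + 1ℚ + 1ℚ) * η))) * (θ * (1ℚ - θ))
    lemma = solve-∀ ℚ-ring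
    coefficient : b * (b * (θ * (1ℚ - θ) * triangular 0 * 1ℚ)
          - a * (θ * (1ℚ - θ) * triangular 1 * (1ℚ - (1ℚ + 1ℚ) * η)))
          ≡ b * (b - a) * (θ * (1ℚ - θ))
    coefficient = trans (lemma a b θ η)
      (trans (cong (λ z → b * (b - a * (1ℚ + (1ℚ + 1ℚ) * (1ℚ - z))) * (θ * (1ℚ - θ)))
        (proj₂ (proj₂ (powerSum-lead 2))))
             (cong (λ z → b * (b - z) * (θ * (1ℚ - θ))) (*-identityʳ a)))

-- Newton's identities

-- Newton's identities for p i = Σ s^(i+1): elementary p q is the q-th elementary
-- symmetric function of the s, and marked p q i is the sum, over all s, of
-- s^(i+1) times the q-th elementary symmetric function of the others.
mutual
  elementary : (ℕ → ℚ) → ℕ → ℚ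
  elementary p zero    = 1ℚ
  elementary p (suc q) = recip (suc q) * marked p q 0

  marked : (ℕ → ℚ) → ℕ → ℕ → ℚ
  marked p zero    i = p i
  marked p (suc q) i = p i * elementary p (suc q) - marked p q (suc i)

double : ℕ → ℕ
double zero    = zero
double (suc n) = suc (suc (double n))

module _ (p : ℕ → ℚ → ℚ) (p-deg : ∀ i → Deg≤ (suc (suc i)) (p i)) where

  private
    e : ℕ → ℚ → ℚ
    e q y = elementary (λ i → p i y) q
    B : ℕ → ℕ → ℚ → ℚ
    B q i y = marked (λ j → p j y) q i

  mutual
    elementary-deg : ∀ q → Deg≤ (double q) (e q)
    elementary-deg zero    = 1ℚ , λ _ → refl
    elementary-deg (suc q) = _ , lead-cast _ (e (suc q)) (ℕ.+-comm (double q) 2)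
      (lead-scale (double q ℕ.+ 2) (recip (suc q)) (proj₂ (marked-deg q 0)))

    marked-deg : ∀ q i → Deg≤ (double q ℕ.+ suc (suc i)) (B q i)
    marked-deg zero    i = p-deg i
    marked-deg (suc q) i = marked-suc-lead q i (proj₂ (p-deg i)) (proj₂ (elementary-deg (suc q)))

    -- The subtracted `B q (suc i)` lies one degree below the product, so the leading coefficient is
    -- that of the product. The witness is the explicit `β * ε - 0ℚ`, from which `marked-positive`
    -- reads off the sign.
    marked-suc-lead : ∀ q i {β ε} → Lead (suc (suc i)) β (p i) → Lead (double (suc q)) ε (e (suc q)) →
      Deg≤ (double (suc q) ℕ.+ suc (suc i)) (B (suc q) i)
    marked-suc-lead q i {β} {ε} lp le = β * ε - 0ℚ ,
      lead-minus (double (suc q) ℕ.+ suc (suc i))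
        (lead-cast (β * ε) (λ y → p i y * e (suc q) y) (ℕ.+-comm (suc (suc i)) (double (suc q)))
          (lead-* (suc (suc i)) (double (suc q)) lp le))
        (lead-cast 0ℚ (B q (suc i)) (cong suc (ℕ.+-suc (double q) (suc (suc i))))
          (lead-raise (double q ℕ.+ suc (suc (suc i))) (proj₂ (marked-deg q (suc i)))))

  module _ (p₀-positive : PositiveLead 2 (p 0)) where

    mutual
      -- Only the products in Newton's recursion reach the top degree: to leading order this is
      -- p_0^q / q!.
      elementary-positive : ∀ q → PositiveLead (double q) (e q)
      elementary-positive zero    = 1ℚ , positive⁻¹ 1ℚ , λ _ → refl
      elementary-positive (suc q) with marked-positive q
      ... | κ , 0<κ , l = recip (suc q) * κ , *-positive (recip-positive (suc q)) 0<κ ,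
        lead-cast _ (e (suc q)) (ℕ.+-comm (double q) 2) (lead-scale (double q ℕ.+ 2) (recip (suc q)) l)

      marked-positive : ∀ q → PositiveLead (double q ℕ.+ 2) (B q 0)
      marked-positive zero    = p₀-positive
      marked-positive (suc q) =
        let β , 0<β , lp = p₀-positive
            ε , 0<ε , le = elementary-positive (suc q)
        in
        β * ε - 0ℚ , subst (0ℚ ℚ.<_) (sym (+-identityʳ (β * ε))) (*-positive 0<β 0<ε) ,
        proj₂ (marked-suc-lead q 0 lp le)

module _
  (p p′ : ℕ → ℚ → ℚ)
  (p-deg : ∀ i → Deg≤ (suc (suc i)) (p i)) (p′-deg : ∀ i → Deg≤ (suc (suc i)) (p′ i))
  (p₀-positive : PositiveLead 2 (p 0)) (p₀≗p′₀ : ∀ y → p 0 y ≡ p′ 0 y)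
  (difference-deg : ∀ i → Deg≤ (suc i) (λ y → p′ (suc i) y - p (suc i) y))
  (difference-positive : PositiveLead 1 (λ y → p′ 1 y - p 1 y))
  where

  private
    e e′ : ℕ → ℚ → ℚ
    e  q y = elementary (λ i → p i y) q
    e′ q y = elementary (λ i → p′ i y) q
    B B′ : ℕ → ℕ → ℚ → ℚ
    B  q i y = marked (λ j → p j y) q i
    B′ q i y = marked (λ j → p′ j y) q i

  mutual
    -- The zero coefficient in degree `double q` is what `marked-difference-suc` needs: multiplied
    -- by `p′ (suc i)`, this difference must not reach the leading term there.
    elementary-difference-low : ∀ q → Lead (double q) 0ℚ (λ y → e (suc q) y - e′ (suc q) y)
    elementary-difference-low zero y = trans
      (cong (λ z → recip 1 * z - recip 1 * p′ 0 y) (p₀≗p′₀ y))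
      (+-inverseʳ (recip 1 * p′ 0 y))
    elementary-difference-low (suc q) =
      lead-raise (suc (double q)) (proj₂ (proj₂ (elementary-difference-positive q)))

    -- As `p 0` and `p′ 0` agree, Newton's recursion writes the difference through `p 0 * (e - e′)`
    -- and `B′ - B`. Both have degree at most 2q + 1. The first has a nonnegative coefficient there,
    -- by induction, and the second a positive one, so they cannot cancel.
    elementary-difference-positive : ∀ q →
      PositiveLead (suc (double q)) (λ y → e (suc (suc q)) y - e′ (suc (suc q)) y)
    elementary-difference-positive q =
      let κ₁ , 0≤κ₁ , l₁ = p₀*elementary-difference q
          κ₂ , 0<κ₂ , l₂ = marked-difference-positive q
      in
      r * (κ₁ + κ₂) ,
      *-positive (recip-positive (suc (suc q))) (ℚ.+-mono-≤-< 0≤κ₁ 0<κ₂) ,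
      lead-ext (suc (double q)) refl pointwise
        (lead-scale (suc (double q)) r (lead-+ (suc (double q)) l₁
          (lead-cast κ₂ (λ y → B′ q 1 y - B q 1 y) (ℕ.+-comm (double q) 1) l₂)))
      where
      r = recip (suc (suc q))
      lemma : ∀ r P E E′ R R′ →
        r * (P * (E - E′) + (R′ - R)) ≡ r * (P * E - R) - r * (P * E′ - R′)
      lemma = solve-∀ ℚ-ring
      pointwise : ∀ y → r * (p 0 y * (e (suc q) y - e′ (suc q) y) + (B′ q 1 y - B q 1 y)) ≡
                        e (suc (suc q)) y - e′ (suc (suc q)) y
      pointwise y = trans (lemma r (p 0 y) (e (suc q) y) (e′ (suc q) y) (B q 1 y) (B′ q 1 y))
        (cong (λ z → e (suc (suc q)) y - r * (z * e′ (suc q) y - B′ q 1 y)) (p₀≗p′₀ y))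

    p₀*elementary-difference : ∀ q → ∃ λ κ → 0ℚ ℚ.≤ κ ×
      Lead (suc (double q)) κ (λ y → p 0 y * (e (suc q) y - e′ (suc q) y))
    p₀*elementary-difference zero = 0ℚ , ℚ.≤-refl ,
      lead-zero 1 (λ y → trans (cong (p 0 y *_) (elementary-difference-low 0 y)) (*-zeroʳ (p 0 y)))
    p₀*elementary-difference (suc q) =
      let β , 0<β , lp = p₀-positive
          κ , 0<κ , le = elementary-difference-positive q
      in β * κ , ℚ.<⇒≤ (*-positive 0<β 0<κ) , lead-* 2 (suc (double q)) lp le

    marked-difference-deg : ∀ q i → Deg≤ (double q ℕ.+ suc i) (λ y → B′ q (suc i) y - B q (suc i) y)
    marked-difference-deg zero    i = difference-deg i
    marked-difference-deg (suc q) i = marked-difference-suc q i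
      (proj₂ (difference-deg i)) (proj₂ (elementary-deg p p-deg (suc q)))

    -- The difference of the products is `(p′ - p) * e - p′ * (e - e′)`. Only `(p′ - p) * e`
    -- contributes in the top degree: the factor `e - e′` has coefficient 0 in degree `double q`,
    -- and the remaining difference of marked sums lies one degree lower. This gives the explicit
    -- coefficient `κ * ε`.
    marked-difference-suc : ∀ q i {κ ε} →
      Lead (suc i) κ (λ y → p′ (suc i) y - p (suc i) y) → Lead (double (suc q)) ε (e (suc q)) →
      Deg≤ (double (suc q) ℕ.+ suc i) (λ y → B′ (suc q) (suc i) y - B (suc q) (suc i) y)
    marked-difference-suc q i {κ} {ε} lp le = κ * ε - 0ℚ - 0ℚ ,
      lead-ext d refl pointwise
        (lead-minus d (lead-minus d
          (lead-cast (κ * ε) (λ y → (p′ (suc i) y - p (suc i) y) * e (suc q) y)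
            (ℕ.+-comm (suc i) (double (suc q)))
            (lead-* (suc i) (double (suc q)) lp le))
          (lead-cast 0ℚ (λ y → p′ (suc i) y * (e (suc q) y - e′ (suc q) y)) degree
            (lead-ext (suc (suc (suc i)) ℕ.+ double q) (*-zeroʳ β′) (λ _ → refl)
              (lead-* (suc (suc (suc i))) (double q) (proj₂ (p′-deg (suc i))) (elementary-difference-low q)))))
          (lead-cast 0ℚ (λ y → B′ q (suc (suc i)) y - B q (suc (suc i)) y)
            (cong suc (ℕ.+-suc (double q) (suc i)))
            (lead-raise (double q ℕ.+ suc (suc i)) (proj₂ (marked-difference-deg q (suc i))))))
      where
      d  = double (suc q) ℕ.+ suc i
      β′ = proj₁ (p′-deg (suc i))
      degree : suc (suc (suc i)) ℕ.+ double q ≡ d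
      degree = cong (λ n → suc (suc n)) (ℕ.+-comm (suc i) (double q))
      lemma : ∀ P P′ E E′ R R′ →
        (P′ - P) * E - P′ * (E - E′) - (R′ - R) ≡ P′ * E′ - R′ - (P * E - R)
      lemma = solve-∀ ℚ-ring
      pointwise : ∀ y → (p′ (suc i) y - p (suc i) y) * e (suc q) y - p′ (suc i) y * (e (suc q) y - e′ (suc q) y)
          - (B′ q (suc (suc i)) y - B q (suc (suc i)) y) ≡ B′ (suc q) (suc i) y - B (suc q) (suc i) y
      pointwise y = lemma (p (suc i) y) (p′ (suc i) y) (e (suc q) y) (e′ (suc q) y)
        (B q (suc (suc i)) y) (B′ q (suc (suc i)) y)

    marked-difference-positive : ∀ q → PositiveLead (double q ℕ.+ 1) (λ y → B′ q 1 y - B q 1 y)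
    marked-difference-positive zero    = difference-positive
    marked-difference-positive (suc q) =
      let κ , 0<κ , lp = difference-positive
          ε , 0<ε , le = elementary-positive p p-deg p₀-positive (suc q)
      in
      κ * ε - 0ℚ - 0ℚ , subst (0ℚ ℚ.<_) (lemma (κ * ε)) (*-positive 0<κ 0<ε) ,
      proj₂ (marked-difference-suc q 0 lp le)
      where
      lemma : ∀ z → z ≡ z - 0ℚ - 0ℚ
      lemma = solve-∀ ℚ-ring

-- Finite sums

private
  variable
    A B P Q : Set

∑ : List A → (A → ℚ) → ℚ
∑ []       f = 0ℚ
∑ (x ∷ xs) f = f x + ∑ xs f

∑< : ℕ → (ℕ → ℚ) → ℚ
∑< zero    f = 0ℚ
∑< (suc n) f = f 0 + ∑< n (f ∘ suc)

⟦_⟧ : Dec P → ℚ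
⟦ yes _ ⟧ = 1ℚ
⟦ no  _ ⟧ = 0ℚ

⟦⟧-yes : ∀ (P? : Dec P) → P → ⟦ P? ⟧ ≡ 1ℚ
⟦⟧-yes (yes _) p = refl
⟦⟧-yes (no ¬p) p = contradiction p ¬p

⟦⟧-no : ∀ (P? : Dec P) → ¬ P → ⟦ P? ⟧ ≡ 0ℚ
⟦⟧-no (yes p) ¬p = contradiction p ¬p
⟦⟧-no (no _)  ¬p = refl

⟦⟧-cong : ∀ (P? : Dec P) (Q? : Dec Q) → (P → Q) → (Q → P) → ⟦ P? ⟧ ≡ ⟦ Q? ⟧
⟦⟧-cong (yes p) Q? to from = sym (⟦⟧-yes Q? (to p))
⟦⟧-cong (no ¬p) Q? to from = sym (⟦⟧-no Q? (¬p ∘ from))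

⟦⟧-× : ∀ (P? : Dec P) (Q? : Dec Q) → ⟦ P? ×-dec Q? ⟧ ≡ ⟦ P? ⟧ * ⟦ Q? ⟧
⟦⟧-× (yes _) (yes _) = refl
⟦⟧-× (yes _) (no _)  = refl
⟦⟧-× (no _)  (yes _) = refl
⟦⟧-× (no _)  (no _)  = refl

interchange : ∀ w x y z → (w + x) + (y + z) ≡ (w + y) + (x + z)
interchange = solve-∀ ℚ-ring

∑-cong-All : ∀ {f g : A → ℚ} {xs} → All (λ x → f x ≡ g x) xs → ∑ xs f ≡ ∑ xs g
∑-cong-All []         = refl
∑-cong-All (px ∷ pxs) = cong₂ _+_ px (∑-cong-All pxs)

∑-cong : ∀ {f g : A → ℚ} → (∀ x → f x ≡ g x) → ∀ xs → ∑ xs f ≡ ∑ xs g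
∑-cong f≗g xs = ∑-cong-All (All.universal f≗g xs)

∑-zero : ∀ (xs : List A) → ∑ xs (λ _ → 0ℚ) ≡ 0ℚ
∑-zero []       = refl
∑-zero (x ∷ xs) = trans (+-identityˡ _) (∑-zero xs)

∑-+ : ∀ (xs : List A) f g → ∑ xs (λ x → f x + g x) ≡ ∑ xs f + ∑ xs g
∑-+ []       f g = refl
∑-+ (x ∷ xs) f g = trans (cong (f x + g x +_) (∑-+ xs f g)) (interchange (f x) (g x) (∑ xs f) (∑ xs g))

∑-*ˡ : ∀ (xs : List A) c f → ∑ xs (λ x → c * f x) ≡ c * ∑ xs f
∑-*ˡ []       c f = sym (*-zeroʳ c)
∑-*ˡ (x ∷ xs) c f = trans (cong (c * f x +_) (∑-*ˡ xs c f)) (sym (*-distribˡ-+ c (f x) (∑ xs f)))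

∑-*ʳ : ∀ (xs : List A) c f → ∑ xs (λ x → f x * c) ≡ ∑ xs f * c
∑-*ʳ []       c f = sym (*-zeroˡ c)
∑-*ʳ (x ∷ xs) c f = trans (cong (f x * c +_) (∑-*ʳ xs c f)) (sym (*-distribʳ-+ c (f x) (∑ xs f)))

∑-++ : ∀ (xs ys : List A) f → ∑ (xs ++ ys) f ≡ ∑ xs f + ∑ ys f
∑-++ []       ys f = sym (+-identityˡ _)
∑-++ (x ∷ xs) ys f = trans (cong (f x +_) (∑-++ xs ys f)) (sym (ℚ.+-assoc (f x) (∑ xs f) (∑ ys f)))

∑-filter : ∀ {P : Pred A 0ℓ} (P? : Decidable P) xs f →
  ∑ (filter P? xs) f ≡ ∑ xs (λ x → ⟦ P? x ⟧ * f x)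
∑-filter P? []       f = refl
∑-filter P? (x ∷ xs) f with P? x
... | yes _ = cong₂ _+_ (sym (*-identityˡ (f x))) (∑-filter P? xs f)
... | no  _ = trans (∑-filter P? xs f) (sym (trans (cong (_+ _) (*-zeroˡ (f x))) (+-identityˡ _)))

fromℕ-length : ∀ (xs : List A) → fromℕ (length xs) ≡ ∑ xs (λ _ → 1ℚ)
fromℕ-length []       = refl
fromℕ-length (x ∷ xs) = trans (fromℕ-suc (length xs)) (cong (1ℚ +_) (fromℕ-length xs))

fromℕ-length-filter : ∀ {P : Pred A 0ℓ} (P? : Decidable P) xs →
  fromℕ (length (filter P? xs)) ≡ ∑ xs (λ x → ⟦ P? x ⟧)
fromℕ-length-filter P? xs = trans (fromℕ-length (filter P? xs))
  (trans (∑-filter P? xs _) (∑-cong (λ x → *-identityʳ ⟦ P? x ⟧) xs))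

∑-map : ∀ (h : B → A) xs (f : A → ℚ) → ∑ (map h xs) f ≡ ∑ xs (f ∘ h)
∑-map h []       f = refl
∑-map h (x ∷ xs) f = cong (f (h x) +_) (∑-map h xs f)

∑-applyUpTo : ∀ (h : ℕ → A) n (f : A → ℚ) → ∑ (applyUpTo h n) f ≡ ∑< n (f ∘ h)
∑-applyUpTo h zero    f = refl
∑-applyUpTo h (suc n) f = cong (f (h 0) +_) (∑-applyUpTo (h ∘ suc) n f)

∑-swap : ∀ (xs : List A) (ys : List B) (f : A → B → ℚ) →
  ∑ xs (λ x → ∑ ys (f x)) ≡ ∑ ys (λ y → ∑ xs (λ x → f x y))
∑-swap []       ys f = sym (∑-zero ys)
∑-swap (x ∷ xs) ys f = trans (cong (∑ ys (f x) +_) (∑-swap xs ys f)) (sym (∑-+ ys (f x) _))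

∑-cartesianProduct : ∀ (xs : List A) (ys : List B) f g →
  ∑ (cartesianProduct xs ys) (λ (x , y) → f x * g y) ≡ ∑ xs f * ∑ ys g
∑-cartesianProduct []       ys f g = sym (*-zeroˡ (∑ ys g))
∑-cartesianProduct (x ∷ xs) ys f g = begin
  ∑ (map (x ,_) ys ++ cartesianProduct xs ys) (λ (x , y) → f x * g y)
    ≡⟨ ∑-++ (map (x ,_) ys) (cartesianProduct xs ys) _ ⟩
  ∑ (map (x ,_) ys) (λ (x , y) → f x * g y) + ∑ (cartesianProduct xs ys) (λ (x , y) → f x * g y)
    ≡⟨ cong₂ _+_ (trans (∑-map (x ,_) ys _) (∑-*ˡ ys (f x) g)) (∑-cartesianProduct xs ys f g) ⟩
  f x * ∑ ys g + ∑ xs f * ∑ ys g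
    ≡⟨ *-distribʳ-+ (∑ ys g) (f x) (∑ xs f) ⟨
  (f x + ∑ xs f) * ∑ ys g ∎
  where open ≡-Reasoning

∑<-cong : ∀ n {f g} → (∀ k → f k ≡ g k) → ∑< n f ≡ ∑< n g
∑<-cong zero    f≗g = refl
∑<-cong (suc n) f≗g = cong₂ _+_ (f≗g 0) (∑<-cong n (f≗g ∘ suc))

∑-∑<-swap : ∀ (xs : List A) n (f : A → ℕ → ℚ) →
  ∑ xs (λ x → ∑< n (f x)) ≡ ∑< n (λ k → ∑ xs (λ x → f x k))
∑-∑<-swap xs n f = trans (∑-cong (λ x → sym (∑-applyUpTo id n (f x))) xs)
  (trans (∑-swap xs (upTo n) f) (∑-applyUpTo id n _))

∑<-zero : ∀ n {f} → (∀ k → f k ≡ 0ℚ) → ∑< n f ≡ 0ℚ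
∑<-zero zero    f≡0 = refl
∑<-zero (suc n) f≡0 = cong₂ _+_ (f≡0 0) (∑<-zero n (f≡0 ∘ suc))

∑<-last : ∀ n f → ∑< (suc n) f ≡ ∑< n f + f n
∑<-last zero    f = ℚ.+-comm (f 0) 0ℚ
∑<-last (suc n) f = trans (cong (f 0 +_) (∑<-last n (f ∘ suc))) (sym (ℚ.+-assoc (f 0) _ _))

∑<-truncate : ∀ {t n} f → t ℕ.≤ n → (∀ k → t ℕ.≤ k → f k ≡ 0ℚ) → ∑< n f ≡ ∑< t f
∑<-truncate {n = n} f ℕ.z≤n       f≡0 = ∑<-zero n (λ k → f≡0 k ℕ.z≤n)
∑<-truncate         f (ℕ.s≤s t≤n) f≡0 = cong (f 0 +_) (∑<-truncate (f ∘ suc) t≤n (λ k t≤k → f≡0 (suc k) (ℕ.s≤s t≤k)))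

∑<-cong-< : ∀ n {f g} → (∀ k → k ℕ.< n → f k ≡ g k) → ∑< n f ≡ ∑< n g
∑<-cong-< zero    f≗g = refl
∑<-cong-< (suc n) f≗g = cong₂ _+_ (f≗g 0 (ℕ.s≤s ℕ.z≤n)) (∑<-cong-< n (λ k k<n → f≗g (suc k) (ℕ.s≤s k<n)))

∑<-unique : ∀ {n m} {P : ℕ → Set} (P? : ∀ k → Dec (P k)) → m ℕ.< n → P m → (∀ k → P k → k ≡ m) →
  ∑< n (λ k → ⟦ P? k ⟧) ≡ 1ℚ
∑<-unique {suc n} {zero}  P? (ℕ.s≤s _) Pm uniq =
  cong₂ _+_ (⟦⟧-yes (P? 0) Pm) (∑<-zero n (λ k → ⟦⟧-no (P? (suc k)) (λ Pk → ℕ.1+n≢0 (uniq (suc k) Pk))))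
∑<-unique {suc n} {suc m} P? (ℕ.s≤s m<n) Pm uniq =
  cong₂ _+_ (⟦⟧-no (P? 0) (λ P0 → ℕ.0≢1+n (uniq 0 P0)))
            (∑<-unique (P? ∘ suc) m<n Pm (λ k Pk → ℕ.suc-injective (uniq (suc k) Pk)))

-- A downward closed P holds on an initial segment, whose length is the sum of the brackets, so the
-- right-hand side telescopes. A nonlinear function of a count thus becomes linear in the brackets,
-- and can then be summed over the board.
∑<-initial : ∀ (Φ : ℚ → ℚ) n {P : ℕ → Set} (P? : ∀ k → Dec (P k)) → (∀ k → P (suc k) → P k) →
  Φ (∑< n (λ k → ⟦ P? k ⟧)) ≡ Φ 0ℚ + ∑< n (λ k → ⟦ P? k ⟧ * (Φ (1ℚ + fromℕ k) - Φ (fromℕ k)))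
∑<-initial Φ zero    P? down = sym (+-identityʳ (Φ 0ℚ))
∑<-initial Φ (suc n) {P} P? down with P? 0
... | yes _ = begin
  Φ (1ℚ + ∑< n (λ k → ⟦ P? (suc k) ⟧))
    ≡⟨ ∑<-initial (λ x → Φ (1ℚ + x)) n (P? ∘ suc) (down ∘ suc) ⟩
  Φ 1ℚ + ∑< n (λ k → ⟦ P? (suc k) ⟧ * (Φ (1ℚ + (1ℚ + fromℕ k)) - Φ (1ℚ + fromℕ k)))
    ≡⟨ cong (Φ 1ℚ +_) (∑<-cong n (λ k → cong (λ z → ⟦ P? (suc k) ⟧ * (Φ (1ℚ + z) - Φ z)) (sym (fromℕ-suc k)))) ⟩
  Φ 1ℚ + rest
    ≡⟨ lemma (Φ 0ℚ) (Φ 1ℚ) rest ⟩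
  Φ 0ℚ + (1ℚ * (Φ 1ℚ - Φ 0ℚ) + rest) ∎
  where
  open ≡-Reasoning
  rest = ∑< n (λ k → ⟦ P? (suc k) ⟧ * (Φ (1ℚ + fromℕ (suc k)) - Φ (fromℕ (suc k))))
  lemma : ∀ p q r → q + r ≡ p + (1ℚ * (q - p) + r)
  lemma = solve-∀ ℚ-ring
... | no ¬P0 = begin
  Φ (0ℚ + ∑< n (λ k → ⟦ P? (suc k) ⟧))
    ≡⟨ cong Φ (∑<-zero (suc n) {λ { zero → 0ℚ ; (suc k) → ⟦ P? (suc k) ⟧ }}
         (λ { zero → refl ; (suc k) → vanish k })) ⟩
  Φ 0ℚ
    ≡⟨ +-identityʳ (Φ 0ℚ) ⟨
  Φ 0ℚ + 0ℚ
    ≡⟨ cong (Φ 0ℚ +_) (cong₂ _+_ (*-zeroˡ (Φ 1ℚ - Φ 0ℚ))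
         (∑<-zero n (λ k → trans (cong (_* step k) (vanish k)) (*-zeroˡ (step k))))) ⟨
  Φ 0ℚ + (0ℚ * (Φ 1ℚ - Φ 0ℚ) + ∑< n (λ k → ⟦ P? (suc k) ⟧ * (Φ (1ℚ + fromℕ (suc k)) - Φ (fromℕ (suc k))))) ∎
  where
  open ≡-Reasoning
  step : ℕ → ℚ
  step k = Φ (1ℚ + fromℕ (suc k)) - Φ (fromℕ (suc k))
  none : ∀ k → ¬ P k
  none zero    = ¬P0
  none (suc k) = none k ∘ down k
  vanish : ∀ k → ⟦ P? (suc k) ⟧ ≡ 0ℚ
  vanish k = ⟦⟧-no (P? (suc k)) (none (suc k))

-- Placements and equivalence classes

length-filter-≐ : ∀ {P Q : Pred A 0ℓ} (P? : Decidable P) (Q? : Decidable Q) → P ≐ Q →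
  ∀ xs → length (filter P? xs) ≡ length (filter Q? xs)
length-filter-≐ P? Q? P≐Q xs = cong length (filter-≐ P? Q? P≐Q xs)

length-filter-map : ∀ {P : Pred B 0ℓ} (P? : Decidable P) (f : A → B) xs →
  length (filter P? (map f xs)) ≡ length (filter (P? ∘ f) xs)
length-filter-map P? f []       = refl
length-filter-map P? f (x ∷ xs) with P? (f x)
... | yes _ = cong suc (length-filter-map P? f xs)
... | no  _ = length-filter-map P? f xs

length-filter-none : ∀ {P : Pred A 0ℓ} (P? : Decidable P) → (∀ x → ¬ P x) →
  ∀ xs → length (filter P? xs) ≡ 0
length-filter-none P? none []       = refl
length-filter-none P? none (x ∷ xs) with P? x
... | yes px = contradiction px (none x)
... | no  _  = length-filter-none P? none xs

length-filter-++ : ∀ {P : Pred A 0ℓ} (P? : Decidable P) xs ys →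
  length (filter P? (xs ++ ys)) ≡ length (filter P? xs) ℕ.+ length (filter P? ys)
length-filter-++ P? xs ys = trans (cong length (filter-++ P? xs ys)) (length-++ (filter P? xs))

-- Once a piece is placed, its constraint on the other pieces becomes a constraint on the list from
-- which they are chosen.
choose-filter : ∀ {P : Pred A 0ℓ} (P? : Decidable P) q xs {Q : Pred (List A) 0ℓ} (Q? : Decidable Q) →
  length (filter (λ ys → all? P? ys ×-dec Q? ys) (choose q xs)) ≡ length (filter Q? (choose q (filter P? xs)))
choose-filter P? zero xs Q? with Q? []
... | yes _ = refl
... | no  _ = refl
choose-filter P? (suc q) []       Q? = refl
choose-filter {A} {P} P? (suc q) (x ∷ xs) {Q} Q? = begin
  length (filter R? (map (x ∷_) (choose q xs) ++ choose (suc q) xs))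
    ≡⟨ length-filter-++ R? (map (x ∷_) (choose q xs)) (choose (suc q) xs) ⟩
  length (filter R? (map (x ∷_) (choose q xs))) ℕ.+ length (filter R? (choose (suc q) xs))
    ≡⟨ cong₂ ℕ._+_ (length-filter-map R? (x ∷_) (choose q xs)) (choose-filter P? (suc q) xs Q?) ⟩
  length (filter (R? ∘ (x ∷_)) (choose q xs)) ℕ.+ length (filter Q? (choose (suc q) (filter P? xs)))
    ≡⟨ split (P? x) ⟩
  length (filter Q? (choose (suc q) (filter P? (x ∷ xs)))) ∎
  where
  open ≡-Reasoning
  R? : Decidable (λ ys → All P ys × Q ys)
  R? ys = all? P? ys ×-dec Q? ys
  split : Dec (P x) →
    length (filter (R? ∘ (x ∷_)) (choose q xs)) ℕ.+ length (filter Q? (choose (suc q) (filter P? xs))) ≡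
    length (filter Q? (choose (suc q) (filter P? (x ∷ xs))))
  split (yes px) = begin
    length (filter (R? ∘ (x ∷_)) (choose q xs)) ℕ.+ length (filter Q? (choose (suc q) (filter P? xs)))
      ≡⟨ cong (ℕ._+ _) (length-filter-≐ (R? ∘ (x ∷_)) (λ ys → all? P? ys ×-dec Q? (x ∷ ys))
           ((λ { (_ ∷ ps , qs) → ps , qs }) , (λ (ps , qs) → px ∷ ps , qs)) (choose q xs)) ⟩
    length (filter (λ ys → all? P? ys ×-dec Q? (x ∷ ys)) (choose q xs)) ℕ.+ _
      ≡⟨ cong (ℕ._+ _) (choose-filter P? q xs (Q? ∘ (x ∷_))) ⟩
    length (filter (Q? ∘ (x ∷_)) (choose q (filter P? xs))) ℕ.+ _
      ≡⟨ cong (ℕ._+ _) (length-filter-map Q? (x ∷_) (choose q (filter P? xs))) ⟨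
    length (filter Q? (map (x ∷_) (choose q (filter P? xs)))) ℕ.+ length (filter Q? (choose (suc q) (filter P? xs)))
      ≡⟨ length-filter-++ Q? (map (x ∷_) (choose q (filter P? xs))) (choose (suc q) (filter P? xs)) ⟨
    length (filter Q? (choose (suc q) (x ∷ filter P? xs)))
      ≡⟨ cong (λ ys → length (filter Q? (choose (suc q) ys))) (filter-accept P? px) ⟨
    length (filter Q? (choose (suc q) (filter P? (x ∷ xs)))) ∎
  split (no ¬px) = trans
    (cong (ℕ._+ _) (length-filter-none (R? ∘ (x ∷_)) (λ { _ (px ∷ _ , _) → ¬px px }) (choose q xs)))
    (cong (λ ys → length (filter Q? (choose (suc q) ys))) (sym (filter-reject P? ¬px)))

-- Choosing pairwise inequivalent entries of a list

module Classes {A : Set} {_~_ : Rel A 0ℓ} (isDecEquivalence : IsDecEquivalence _~_) where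

  open IsDecEquivalence isDecEquivalence
    using () renaming (_≟_ to _~?_; refl to ~-refl; sym to ~-sym; trans to ~-trans)

  class others : A → List A → List A
  class  x = filter (x ~?_)
  others x = filter (λ y → ¬? (x ~? y))

  apart? : Decidable (AllPairs (λ x y → ¬ (x ~ y)))
  apart? = allPairs? (λ x y → ¬? (x ~? y))

  -- For the attack relation and the list `board n` this unfolds to `u`.
  N : ℕ → List A → ℕ
  N q xs = length (filter apart? (choose q xs))

  N-step : ∀ q x xs → N (suc q) (x ∷ xs) ≡ N q (others x xs) ℕ.+ N (suc q) xs
  N-step q x xs = begin
    N (suc q) (x ∷ xs)
      ≡⟨ length-filter-++ apart? (map (x ∷_) (choose q xs)) (choose (suc q) xs) ⟩
    length (filter apart? (map (x ∷_) (choose q xs))) ℕ.+ N (suc q) xs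
      ≡⟨ cong (ℕ._+ N (suc q) xs) (length-filter-map apart? (x ∷_) (choose q xs)) ⟩
    length (filter (apart? ∘ (x ∷_)) (choose q xs)) ℕ.+ N (suc q) xs
      ≡⟨ cong (ℕ._+ N (suc q) xs) (length-filter-≐ (apart? ∘ (x ∷_))
           (λ ys → all? (λ y → ¬? (x ~? y)) ys ×-dec apart? ys)
           ((λ { (ps ∷ pss) → ps , pss }) , (λ (ps , pss) → ps ∷ pss)) (choose q xs)) ⟩
    length (filter (λ ys → all? (λ y → ¬? (x ~? y)) ys ×-dec apart? ys) (choose q xs)) ℕ.+ N (suc q) xs
      ≡⟨ cong (ℕ._+ N (suc q) xs) (choose-filter (λ y → ¬? (x ~? y)) q xs apart?) ⟩
    N q (others x xs) ℕ.+ N (suc q) xs ∎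
    where open ≡-Reasoning

  others-accept : ∀ {x y ys} → ¬ (x ~ y) → others x (y ∷ ys) ≡ y ∷ others x ys
  others-accept {x} = filter-accept (λ y → ¬? (x ~? y))

  others-reject : ∀ {x y ys} → x ~ y → others x (y ∷ ys) ≡ others x ys
  others-reject {x} x~y = filter-reject (λ y → ¬? (x ~? y)) (λ x≁y → x≁y x~y)

  class-accept : ∀ {x y ys} → x ~ y → class x (y ∷ ys) ≡ y ∷ class x ys
  class-accept {x} = filter-accept (x ~?_)

  class-reject : ∀ {x y ys} → ¬ (x ~ y) → class x (y ∷ ys) ≡ class x ys
  class-reject {x} = filter-reject (x ~?_)

  others-cong : ∀ {x y} → x ~ y → ∀ xs → others x xs ≡ others y xs
  others-cong {x} {y} x~y = filter-≐ (λ z → ¬? (x ~? z)) (λ z → ¬? (y ~? z))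
    ((λ x≁z y~z → x≁z (~-trans x~y y~z)) , (λ y≁z x~z → y≁z (~-trans (~-sym x~y) x~z)))

  class-cong : ∀ {x y} → x ~ y → ∀ xs → class x xs ≡ class y xs
  class-cong {x} {y} x~y = filter-≐ (x ~?_) (y ~?_)
    ((λ x~z → ~-trans (~-sym x~y) x~z) , (λ y~z → ~-trans x~y y~z))

  others-comm : ∀ x y xs → others x (others y xs) ≡ others y (others x xs)
  others-comm x y []       = refl
  others-comm x y (z ∷ zs) = case-split (x ~? z) (y ~? z)
    where
    IH = others-comm x y zs
    case-split : Dec (x ~ z) → Dec (y ~ z) → others x (others y (z ∷ zs)) ≡ others y (others x (z ∷ zs))
    case-split (yes x~z) (yes y~z) =
      trans (cong (others x) (others-reject y~z)) (trans IH (sym (cong (others y) (others-reject x~z))))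
    case-split (yes x~z) (no  y≁z) = trans (cong (others x) (others-accept y≁z))
      (trans (others-reject x~z) (trans IH (sym (cong (others y) (others-reject x~z)))))
    case-split (no  x≁z) (yes y~z) = trans (cong (others x) (others-reject y~z))
      (trans IH (sym (trans (cong (others y) (others-accept x≁z)) (others-reject y~z))))
    case-split (no  x≁z) (no  y≁z) = trans (cong (others x) (others-accept y≁z))
      (trans (others-accept x≁z) (trans (cong (z ∷_) IH)
        (sym (trans (cong (others y) (others-accept x≁z)) (others-accept y≁z)))))

  class-others : ∀ {x y} → ¬ (x ~ y) → ∀ xs → class x (others y xs) ≡ class x xs
  class-others x≁y []       = refl
  class-others {x} {y} x≁y (z ∷ zs) = case-split (x ~? z) (y ~? z)
    where
    IH = class-others x≁y zs
    case-split : Dec (x ~ z) → Dec (y ~ z) → class x (others y (z ∷ zs)) ≡ class x (z ∷ zs)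
    case-split (yes x~z) (yes y~z) = contradiction (~-trans x~z (~-sym y~z)) x≁y
    case-split (no  x≁z) (yes y~z) =
      trans (cong (class x) (others-reject y~z)) (trans IH (sym (class-reject x≁z)))
    case-split (yes x~z) (no  y≁z) = trans (cong (class x) (others-accept y≁z))
      (trans (class-accept x~z) (trans (cong (z ∷_) IH) (sym (class-accept x~z))))
    case-split (no  x≁z) (no  y≁z) = trans (cong (class x) (others-accept y≁z))
      (trans (class-reject x≁z) (trans IH (sym (class-reject x≁z))))

  -- A choice either avoids the class of x or uses exactly one of its members, and any of them will
  -- do. The entry x need not occur in the list, so it can stay fixed while the list shrinks.
  N-remove : ∀ q x xs → N (suc q) xs ≡ N (suc q) (others x xs) ℕ.+ length (class x xs) ℕ.* N q (others x xs)
  N-remove q x []       = refl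
  N-remove q x (y ∷ ys) = case-split (x ~? y)
    where
    open ≡-Reasoning
    IH = N-remove q x ys
    n₀ = N q (others x ys)
    n₁ = N (suc q) (others x ys)
    s  = length (class x ys)
    lemma₁ : ∀ n₀ n₁ s → n₀ ℕ.+ (n₁ ℕ.+ s ℕ.* n₀) ≡ n₁ ℕ.+ suc s ℕ.* n₀
    lemma₁ = ℕSolver.solve-∀
    lemma₂ : ∀ m₀ m₁ n₁ s n₀ → (m₁ ℕ.+ s ℕ.* m₀) ℕ.+ (n₁ ℕ.+ s ℕ.* n₀) ≡ (m₁ ℕ.+ n₁) ℕ.+ s ℕ.* (m₀ ℕ.+ n₀)
    lemma₂ = ℕSolver.solve-∀
    case-split : Dec (x ~ y) →
      N (suc q) (y ∷ ys) ≡ N (suc q) (others x (y ∷ ys)) ℕ.+ length (class x (y ∷ ys)) ℕ.* N q (others x (y ∷ ys))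
    case-split (yes x~y) = begin
      N (suc q) (y ∷ ys)                      ≡⟨ N-step q y ys ⟩
      N q (others y ys) ℕ.+ N (suc q) ys      ≡⟨ cong₂ ℕ._+_ (cong (N q) (others-cong (~-sym x~y) ys)) IH ⟩
      n₀ ℕ.+ (n₁ ℕ.+ s ℕ.* n₀)                ≡⟨ lemma₁ n₀ n₁ s ⟩
      n₁ ℕ.+ suc s ℕ.* n₀
        ≡⟨ cong₂ (λ zs ws → N (suc q) zs ℕ.+ length ws ℕ.* N q zs)
             (others-reject x~y) (class-accept x~y) ⟨
      N (suc q) (others x (y ∷ ys)) ℕ.+ length (class x (y ∷ ys)) ℕ.* N q (others x (y ∷ ys)) ∎
    case-split (no x≁y) = begin
      N (suc q) (y ∷ ys)                                     ≡⟨ N-step q y ys ⟩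
      N q (others y ys) ℕ.+ N (suc q) ys                     ≡⟨ reduce q IH ⟩
      N (suc q) (y ∷ others x ys) ℕ.+ s ℕ.* N q (y ∷ others x ys)
        ≡⟨ cong₂ (λ zs ws → N (suc q) zs ℕ.+ length ws ℕ.* N q zs) (others-accept x≁y) (class-reject x≁y) ⟨
      N (suc q) (others x (y ∷ ys)) ℕ.+ length (class x (y ∷ ys)) ℕ.* N q (others x (y ∷ ys)) ∎
      where
      -- `others y ys` is not a tail of `y ∷ ys`, so the recursive call on it is for a smaller
      -- number of pieces. For q = 0 there is nothing left to choose from it.
      reduce : ∀ q → N (suc q) ys ≡ N (suc q) (others x ys) ℕ.+ s ℕ.* N q (others x ys) →
        N q (others y ys) ℕ.+ N (suc q) ys ≡ N (suc q) (y ∷ others x ys) ℕ.+ s ℕ.* N q (y ∷ others x ys)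
      reduce zero    eq = trans (cong suc eq) (sym (cong (ℕ._+ s ℕ.* 1) (N-step 0 y (others x ys))))
      reduce (suc q) eq = begin
        N (suc q) (others y ys) ℕ.+ N (suc (suc q)) ys
          ≡⟨ cong₂ ℕ._+_ (N-remove q x (others y ys)) eq ⟩
        (N (suc q) (others x (others y ys)) ℕ.+ length (class x (others y ys)) ℕ.* N q (others x (others y ys)))
          ℕ.+ (N (suc (suc q)) (others x ys) ℕ.+ s ℕ.* N (suc q) (others x ys))
          ≡⟨ cong (ℕ._+ (N (suc (suc q)) (others x ys) ℕ.+ s ℕ.* N (suc q) (others x ys)))
               (cong₂ (λ zs ws → N (suc q) zs ℕ.+ length ws ℕ.* N q zs)
                 (others-comm x y ys) (class-others x≁y ys)) ⟩
        (N (suc q) (others y (others x ys)) ℕ.+ s ℕ.* N q (others y (others x ys)))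
          ℕ.+ (N (suc (suc q)) (others x ys) ℕ.+ s ℕ.* N (suc q) (others x ys))
          ≡⟨ lemma₂ (N q (others y (others x ys))) (N (suc q) (others y (others x ys)))
               (N (suc (suc q)) (others x ys)) s (N (suc q) (others x ys)) ⟩
        (N (suc q) (others y (others x ys)) ℕ.+ N (suc (suc q)) (others x ys))
          ℕ.+ s ℕ.* (N q (others y (others x ys)) ℕ.+ N (suc q) (others x ys))
          ≡⟨ cong₂ (λ m₁ m₀ → m₁ ℕ.+ s ℕ.* m₀) (N-step (suc q) y (others x ys)) (N-step q y (others x ys)) ⟨
        N (suc (suc q)) (y ∷ others x ys) ℕ.+ s ℕ.* N (suc q) (y ∷ others x ys) ∎

  count : ℕ → List A → ℚ
  count q xs = fromℕ (N q xs)

  size : A → List A → ℚ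
  size x xs = fromℕ (length (class x xs))

  count-step : ∀ q x xs → count (suc q) (x ∷ xs) ≡ count q (others x xs) + count (suc q) xs
  count-step q x xs = trans (cong fromℕ (N-step q x xs)) (fromℕ-homo-+ (N q (others x xs)) _)

  count-remove : ∀ q x xs → count (suc q) xs ≡ count (suc q) (others x xs) + size x xs * count q (others x xs)
  count-remove q x xs = trans (cong fromℕ (N-remove q x xs))
    (trans (fromℕ-homo-+ (N (suc q) (others x xs)) _)
      (cong (count (suc q) (others x xs) +_) (fromℕ-homo-* (length (class x xs)) (N q (others x xs)))))

  -- Every placement is counted once for each of its pieces.
  count-marked : ∀ q xs → fromℕ (suc q) * count (suc q) xs ≡ ∑ xs (λ x → count q (others x xs))
  count-marked q       []       = *-zeroʳ (fromℕ (suc q))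
  count-marked zero    (y ∷ ys) = begin
    1ℚ * count 1 (y ∷ ys)     ≡⟨ *-identityˡ _ ⟩
    count 1 (y ∷ ys)          ≡⟨ count-step 0 y ys ⟩
    1ℚ + count 1 ys
      ≡⟨ cong (1ℚ +_) (trans (sym (*-identityˡ (count 1 ys))) (count-marked zero ys)) ⟩
    1ℚ + ∑ ys (λ _ → 1ℚ)      ∎
    where open ≡-Reasoning
  count-marked (suc q) (y ∷ ys) = begin
    fromℕ (suc (suc q)) * count (suc (suc q)) (y ∷ ys)
      ≡⟨ cong₂ _*_ (fromℕ-suc (suc q)) (count-step (suc q) y ys) ⟩
    (1ℚ + fromℕ (suc q)) * (c + count (suc (suc q)) ys)
      ≡⟨ lemma (fromℕ (suc q)) c (count (suc (suc q)) ys) ⟩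
    c + ((1ℚ + fromℕ (suc q)) * count (suc (suc q)) ys + fromℕ (suc q) * c)
      ≡⟨ cong (c +_) (cong₂ _+_
           (trans (cong (_* count (suc (suc q)) ys) (sym (fromℕ-suc (suc q)))) (count-marked (suc q) ys))
           (trans (count-marked q (others y ys))
             (∑-filter (λ x → ¬? (y ~? x)) ys (λ x → count q (others x (others y ys)))))) ⟩
    c + (∑ ys (λ x → count (suc q) (others x ys)) + ∑ ys (λ x → ⟦ ¬? (y ~? x) ⟧ * count q (others x (others y ys))))
      ≡⟨ cong (c +_) (∑-+ ys _ _) ⟨
    c + ∑ ys (λ x → count (suc q) (others x ys) + ⟦ ¬? (y ~? x) ⟧ * count q (others x (others y ys)))
      ≡⟨ cong₂ _+_ (cong (count (suc q)) (sym (others-reject ~-refl))) (∑-cong tail-term ys) ⟩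
    count (suc q) (others y (y ∷ ys)) + ∑ ys (λ x → count (suc q) (others x (y ∷ ys))) ∎
    where
    open ≡-Reasoning
    c = count (suc q) (others y ys)
    lemma : ∀ n c r → (1ℚ + n) * (c + r) ≡ c + ((1ℚ + n) * r + n * c)
    lemma = solve-∀ ℚ-ring
    tail-term : ∀ x → count (suc q) (others x ys) + ⟦ ¬? (y ~? x) ⟧ * count q (others x (others y ys)) ≡
                      count (suc q) (others x (y ∷ ys))
    tail-term x = split (y ~? x)
      where
      split : (y~?x : Dec (y ~ x)) →
        count (suc q) (others x ys) + ⟦ ¬? y~?x ⟧ * count q (others x (others y ys)) ≡
        count (suc q) (others x (y ∷ ys))
      split (yes y~x) = trans (cong (count (suc q) (others x ys) +_) (*-zeroˡ (count q (others x (others y ys)))))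
        (trans (+-identityʳ (count (suc q) (others x ys))) (cong (count (suc q)) (sym (others-reject (~-sym y~x)))))
      split (no y≁x) = begin
        count (suc q) (others x ys) + 1ℚ * count q (others x (others y ys))
          ≡⟨ ℚ.+-comm (count (suc q) (others x ys)) (1ℚ * count q (others x (others y ys))) ⟩
        1ℚ * count q (others x (others y ys)) + count (suc q) (others x ys)
          ≡⟨ cong (_+ count (suc q) (others x ys))
               (trans (*-identityˡ (count q (others x (others y ys)))) (cong (count q) (others-comm x y ys))) ⟩
        count q (others y (others x ys)) + count (suc q) (others x ys)
          ≡⟨ count-step q y (others x ys) ⟨
        count (suc q) (y ∷ others x ys)
          ≡⟨ cong (count (suc q)) (others-accept (y≁x ∘ ~-sym)) ⟨
        count (suc q) (others x (y ∷ ys)) ∎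

  -- The sum runs over entries instead of classes, so a class of size s contributes s^(i + 1): this
  -- is the p of Newton's identities.
  powers : List A → ℕ → ℚ
  powers xs i = ∑ xs (λ x → size x xs ^ i)

  mutual
    count≡elementary : ∀ q xs → count q xs ≡ elementary (powers xs) q
    count≡elementary zero    xs = refl
    count≡elementary (suc q) xs = begin
      count (suc q) xs
        ≡⟨ *-identityˡ _ ⟨
      1ℚ * count (suc q) xs
        ≡⟨ cong (_* count (suc q) xs) (trans (ℚ.*-comm (recip (suc q)) _) (fromℕ-*-recip (suc q))) ⟨
      recip (suc q) * fromℕ (suc q) * count (suc q) xs
        ≡⟨ ℚ.*-assoc (recip (suc q)) (fromℕ (suc q)) (count (suc q) xs) ⟩
      recip (suc q) * (fromℕ (suc q) * count (suc q) xs)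
        ≡⟨ cong (recip (suc q) *_) (trans (count-marked q xs) (∑-cong (λ x → sym (*-identityˡ _)) xs)) ⟩
      recip (suc q) * ∑ xs (λ x → size x xs ^ 0 * count q (others x xs))
        ≡⟨ cong (recip (suc q) *_) (count≡marked q 0 xs) ⟩
      recip (suc q) * marked (powers xs) q 0 ∎
      where open ≡-Reasoning

    -- `count-remove`, multiplied by `size x xs ^ i` and summed over x, is the recursion that
    -- defines `marked`.
    count≡marked : ∀ q i xs → ∑ xs (λ x → size x xs ^ i * count q (others x xs)) ≡ marked (powers xs) q i
    count≡marked zero    i xs = ∑-cong (λ x → *-identityʳ (size x xs ^ i)) xs
    count≡marked (suc q) i xs = begin
      ∑ xs (λ x → size x xs ^ i * count (suc q) (others x xs))
        ≡⟨ lemma₁ _ (∑ xs (λ x → size x xs ^ suc i * count q (others x xs))) ⟩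
      ∑ xs (λ x → size x xs ^ i * count (suc q) (others x xs))
        + ∑ xs (λ x → size x xs ^ suc i * count q (others x xs))
        - ∑ xs (λ x → size x xs ^ suc i * count q (others x xs))
        ≡⟨ cong₂ _-_ (sym (∑-+ xs _ _)) (count≡marked q (suc i) xs) ⟩
      ∑ xs (λ x → size x xs ^ i * count (suc q) (others x xs) + size x xs ^ suc i * count q (others x xs))
        - marked (powers xs) q (suc i)
        ≡⟨ cong (_- marked (powers xs) q (suc i)) (∑-cong pointwise xs) ⟩
      ∑ xs (λ x → size x xs ^ i * count (suc q) xs) - marked (powers xs) q (suc i)
        ≡⟨ cong (_- marked (powers xs) q (suc i)) (∑-*ʳ xs (count (suc q) xs) _) ⟩
      powers xs i * count (suc q) xs - marked (powers xs) q (suc i)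
        ≡⟨ cong (λ z → powers xs i * z - marked (powers xs) q (suc i)) (count≡elementary (suc q) xs) ⟩
      powers xs i * elementary (powers xs) (suc q) - marked (powers xs) q (suc i) ∎
      where
      open ≡-Reasoning
      lemma₁ : ∀ u v → u ≡ u + v - v
      lemma₁ = solve-∀ ℚ-ring
      lemma₂ : ∀ p s u v → p * u + s * p * v ≡ p * (u + s * v)
      lemma₂ = solve-∀ ℚ-ring
      pointwise : ∀ x → size x xs ^ i * count (suc q) (others x xs) + size x xs ^ suc i * count q (others x xs) ≡
                        size x xs ^ i * count (suc q) xs
      pointwise x = trans (lemma₂ (size x xs ^ i) (size x xs) _ _)
        (cong (size x xs ^ i *_) (sym (count-remove q x xs)))

  size-accept : ∀ {x y} ys → x ~ y → size x (y ∷ ys) ≡ 1ℚ + size x ys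
  size-accept {x} ys x~y = trans (cong (fromℕ ∘ length) (class-accept x~y)) (fromℕ-suc (length (class x ys)))

  size-reject : ∀ {x y} ys → ¬ (x ~ y) → size x (y ∷ ys) ≡ size x ys
  size-reject ys x≁y = cong (fromℕ ∘ length) (class-reject x≁y)

  size≡∑ : ∀ x xs → size x xs ≡ ∑ xs (λ y → ⟦ x ~? y ⟧)
  size≡∑ x = fromℕ-length-filter (x ~?_)

  -- With s the old size of the class of y, each of its s members passes from s^i to (1 + s)^i, and
  -- y itself adds (1 + s)^i. The total change is (1 + s)^(i + 1) - s^(i + 1).
  powers-∷ : ∀ i y ys →
    powers (y ∷ ys) i ≡ ((1ℚ + size y ys) ^ suc i - size y ys ^ suc i) + powers ys i
  powers-∷ i y ys = begin
    size y (y ∷ ys) ^ i + ∑ ys (λ x → size x (y ∷ ys) ^ i)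
      ≡⟨ cong₂ _+_ (cong (_^ i) (size-accept ys ~-refl)) (∑-cong tail-term ys) ⟩
    (1ℚ + s) ^ i + ∑ ys (λ x → ⟦ y ~? x ⟧ * ((1ℚ + s) ^ i - s ^ i) + size x ys ^ i)
      ≡⟨ cong ((1ℚ + s) ^ i +_) (∑-+ ys _ _) ⟩
    (1ℚ + s) ^ i + (∑ ys (λ x → ⟦ y ~? x ⟧ * ((1ℚ + s) ^ i - s ^ i)) + powers ys i)
      ≡⟨ cong (λ z → (1ℚ + s) ^ i + (z + powers ys i))
           (trans (∑-*ʳ ys ((1ℚ + s) ^ i - s ^ i) (λ x → ⟦ y ~? x ⟧))
             (cong (_* ((1ℚ + s) ^ i - s ^ i)) (sym (size≡∑ y ys)))) ⟩
    (1ℚ + s) ^ i + (s * ((1ℚ + s) ^ i - s ^ i) + powers ys i)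
      ≡⟨ lemma s ((1ℚ + s) ^ i) (s ^ i) (powers ys i) ⟩
    (1ℚ + s) ^ suc i - s ^ suc i + powers ys i ∎
    where
    open ≡-Reasoning
    s = size y ys
    lemma : ∀ s u v p → u + (s * (u - v) + p) ≡ (1ℚ + s) * u - s * v + p
    lemma = solve-∀ ℚ-ring
    lemma₁ : ∀ u v → u ≡ 1ℚ * (u - v) + v
    lemma₁ = solve-∀ ℚ-ring
    tail-term : ∀ x → size x (y ∷ ys) ^ i ≡ ⟦ y ~? x ⟧ * ((1ℚ + s) ^ i - s ^ i) + size x ys ^ i
    tail-term x = split (y ~? x)
      where
      split : (y~?x : Dec (y ~ x)) → size x (y ∷ ys) ^ i ≡ ⟦ y~?x ⟧ * ((1ℚ + s) ^ i - s ^ i) + size x ys ^ i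
      split (yes y~x) = begin
        size x (y ∷ ys) ^ i                          ≡⟨ cong (_^ i) (size-accept ys (~-sym y~x)) ⟩
        (1ℚ + size x ys) ^ i                         ≡⟨ lemma₁ _ (size x ys ^ i) ⟩
        1ℚ * ((1ℚ + size x ys) ^ i - size x ys ^ i) + size x ys ^ i
          ≡⟨ cong (λ z → 1ℚ * ((1ℚ + fromℕ (length z)) ^ i - fromℕ (length z) ^ i) + size x ys ^ i)
               (class-cong (~-sym y~x) ys) ⟩
        1ℚ * ((1ℚ + s) ^ i - s ^ i) + size x ys ^ i  ∎
      split (no y≁x) = trans (cong (_^ i) (size-reject ys (y≁x ∘ ~-sym)))
        (sym (trans (cong (_+ size x ys ^ i) (*-zeroˡ ((1ℚ + s) ^ i - s ^ i))) (+-identityˡ (size x ys ^ i))))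

  -- A class of size s contributes Σ_{j<s} ((1 + j)^(i+1) - j^(i+1)), where j runs
  -- over the numbers of later members of the class in list order.
  powers-ordered : ∀ i (F : A → A → ℚ) → (∀ x → F x x ≡ 0ℚ) → ∀ {xs} →
    AllPairs (λ x y → ⟦ x ~? y ⟧ ≡ F x y × F y x ≡ 0ℚ) xs →
    powers xs i ≡ ∑ xs (λ x → (1ℚ + ∑ xs (F x)) ^ suc i - ∑ xs (F x) ^ suc i)
  powers-ordered i F F-irrefl {[]}     []             = refl
  powers-ordered i F F-irrefl {y ∷ ys} (later ∷ rest) = trans (powers-∷ i y ys) (cong₂ _+_
    (cong (λ z → (1ℚ + z) ^ suc i - z ^ suc i) (trans (size≡∑ y ys)
      (trans (∑-cong-All (All.map proj₁ later))
        (sym (trans (cong (_+ ∑ ys (F y)) (F-irrefl y)) (+-identityˡ (∑ ys (F y))))))))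
    (trans (powers-ordered i F F-irrefl rest) (∑-cong-All (All.map
      (λ {x} (_ , Fxy≡0) → cong (λ z → (1ℚ + z) ^ suc i - z ^ suc i)
        (sym (trans (cong (_+ ∑ ys (F x)) Fxy≡0) (+-identityˡ (∑ ys (F x)))))) later))))

-- The board

attacks-refl : ∀ m z → Attacks m z z
attacks-refl (c , d) (x , y) = 0ℤ , lemma x c , lemma y d
  where
  lemma : ∀ x c → x ℤ.- x ≡ 0ℤ ℤ.* c
  lemma = ℤSolver.solve-∀

attacks-sym : ∀ m z z′ → Attacks m z z′ → Attacks m z′ z
attacks-sym (c , d) (x , y) (x′ , y′) (k , x≡ , y≡) = ℤ.- k , flip x x′ c x≡ , flip y y′ d y≡
  where
  lemma₁ : ∀ x x′ → x ℤ.- x′ ≡ ℤ.- (x′ ℤ.- x)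
  lemma₁ = ℤSolver.solve-∀
  lemma₂ : ∀ k c → ℤ.- (k ℤ.* c) ≡ ℤ.- k ℤ.* c
  lemma₂ = ℤSolver.solve-∀
  flip : ∀ x x′ c → x′ ℤ.- x ≡ k ℤ.* c → x ℤ.- x′ ≡ ℤ.- k ℤ.* c
  flip x x′ c eq = trans (lemma₁ x x′) (trans (cong ℤ.-_ eq) (lemma₂ k c))

attacks-trans : ∀ m z z′ z″ → Attacks m z z′ → Attacks m z′ z″ → Attacks m z z″
attacks-trans (c , d) (x , y) (x′ , y′) (x″ , y″) (k , x≡ , y≡) (l , x≡′ , y≡′) =
  k ℤ.+ l , add x x′ x″ c x≡ x≡′ , add y y′ y″ d y≡ y≡′
  where
  lemma₁ : ∀ x x′ x″ → x″ ℤ.- x ≡ (x′ ℤ.- x) ℤ.+ (x″ ℤ.- x′)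
  lemma₁ = ℤSolver.solve-∀
  add : ∀ x x′ x″ c → x′ ℤ.- x ≡ k ℤ.* c → x″ ℤ.- x′ ≡ l ℤ.* c → x″ ℤ.- x ≡ (k ℤ.+ l) ℤ.* c
  add x x′ x″ c eq eq′ = trans (lemma₁ x x′ x″)
    (trans (cong₂ ℤ._+_ eq eq′) (sym (ℤ.*-distribʳ-+ c k l)))

attacks-isDecEquivalence : ∀ m → IsDecEquivalence (Attacks m)
attacks-isDecEquivalence m = record
  { isEquivalence = record
    { refl  = λ {z} → attacks-refl m z
    ; sym   = λ {z} {z′} → attacks-sym m z z′
    ; trans = λ {z} {z′} {z″} → attacks-trans m z z′ z″
    }
  ; _≟_ = attacks? m
  }

module AttackClasses (m : ℤ × ℤ) = Classes (attacks-isDecEquivalence m)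

Range : ℕ → ℤ → Set
Range n x = 0ℤ ℤ.< x × x ℤ.≤ ℤ.+ n

range? : ∀ n x → Dec (Range n x)
range? n x = (0ℤ ℤ.<? x) ×-dec (x ℤ.≤? ℤ.+ n)

-- A copy of the list local to `board`, so that `board n` is by definition the product of
-- `coordinates n` with itself.
coordinates : ℕ → List ℤ
coordinates n = map (λ i → +[1+ i ]) (upTo n)

∑-coordinates : ∀ n f → ∑ (coordinates n) f ≡ ∑< n (λ i → f +[1+ i ])
∑-coordinates n f = trans (∑-map +[1+_] (upTo n) f) (∑-applyUpTo id n (f ∘ +[1+_]))

coordinates-range : ∀ n → All (Range n) (coordinates n)
coordinates-range n = All.map⁺ (All.applyUpTo⁺₁ id n (λ i<n → +<+ ℕ.z<s , +≤+ i<n))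

coordinates-ascending : ∀ n → AllPairs ℤ._<_ (coordinates n)
coordinates-ascending n = AllPairs.map⁺ (AllPairs.applyUpTo⁺₁ id n (λ i<j _ → +<+ (ℕ.s<s i<j)))

∑-coordinates-≟ : ∀ n z → ∑ (coordinates n) (λ x → ⟦ x ℤ.≟ z ⟧) ≡ ⟦ range? n z ⟧
∑-coordinates-≟ n z = trans (∑-coordinates n _) (split z (range? n z))
  where
  split : ∀ z (r : Dec (Range n z)) → ∑< n (λ i → ⟦ +[1+ i ] ℤ.≟ z ⟧) ≡ ⟦ r ⟧
  split +[1+ m ] (yes (_ , +≤+ m<n)) =
    ∑<-unique (λ i → +[1+ i ] ℤ.≟ +[1+ m ]) m<n refl (λ { _ refl → refl })
  split (ℤ.+ 0)      (yes (+<+ () , _))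
  split (-[1+ _ ]) (yes (() , _))
  split z (no ¬r) = trans
    (∑<-cong-< n (λ i i<n → ⟦⟧-no (+[1+ i ] ℤ.≟ z) (λ { refl → ¬r (+<+ ℕ.z<s , +≤+ i<n) })))
    (∑<-zero n (λ _ → refl))

∑<-below : ∀ {r n} → r ℕ.≤ n → ∑< n (λ i → ⟦ i ℕ.<? r ⟧) ≡ fromℕ r
∑<-below {zero}  {n}     _           = ∑<-zero n (λ i → ⟦⟧-no (i ℕ.<? 0) (λ ()))
∑<-below {suc r} {suc n} (ℕ.s≤s r≤n) = begin
  ⟦ 0 ℕ.<? suc r ⟧ + ∑< n (λ i → ⟦ suc i ℕ.<? suc r ⟧)
    ≡⟨ cong₂ _+_ (⟦⟧-yes (0 ℕ.<? suc r) ℕ.z<s)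
         (∑<-cong n (λ i → ⟦⟧-cong (suc i ℕ.<? suc r) (i ℕ.<? r) ℕ.s<s⁻¹ ℕ.s<s)) ⟩
  1ℚ + ∑< n (λ i → ⟦ i ℕ.<? r ⟧)   ≡⟨ cong (1ℚ +_) (∑<-below r≤n) ⟩
  1ℚ + fromℕ r                     ≡⟨ fromℕ-suc r ⟨
  fromℕ (suc r)                    ∎
  where open ≡-Reasoning

∑-shifted-range : ∀ n e → ∑ (coordinates n) (λ x → ⟦ range? n (x ℤ.+ e) ⟧) ≡ fromℕ (n ∸ ∣ e ∣)
∑-shifted-range n (ℤ.+ m) = begin
  ∑ (coordinates n) (λ x → ⟦ range? n (x ℤ.+ ℤ.+ m) ⟧)
    ≡⟨ ∑-coordinates n _ ⟩
  ∑< n (λ i → ⟦ range? n (ℤ.+ (suc i ℕ.+ m)) ⟧)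
    ≡⟨ ∑<-cong n (λ i → ⟦⟧-cong (range? n (ℤ.+ (suc i ℕ.+ m))) (i ℕ.<? n ∸ m)
         (λ { (_ , +≤+ i+m<n) → ℕ.m+n≤o⇒m≤o∸n (suc i) i+m<n })
         (λ i<n∸m → +<+ ℕ.z<s , +≤+ (ℕ.m≤o∸n⇒m+n≤o (suc i)
           (ℕ.<⇒≤ (ℕ.m∸n≢0⇒n<m (λ eq → ℕ.n≮0 (subst (i ℕ.<_) eq i<n∸m)))) i<n∸m))) ⟩
  ∑< n (λ i → ⟦ i ℕ.<? n ∸ m ⟧)
    ≡⟨ ∑<-below (ℕ.m∸n≤m n m) ⟩
  fromℕ (n ∸ m) ∎
  where open ≡-Reasoning
-- Counting the pairs with `x′ ≡ x + e` by `x′` instead of by x turns a negative shift into a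
-- positive one.
∑-shifted-range n e@(-[1+ m ]) = begin
  ∑ (coordinates n) (λ x → ⟦ range? n (x ℤ.+ e) ⟧)
    ≡⟨ ∑-cong (λ x → sym (∑-coordinates-≟ n (x ℤ.+ e))) (coordinates n) ⟩
  ∑ (coordinates n) (λ x → ∑ (coordinates n) (λ x′ → ⟦ x′ ℤ.≟ x ℤ.+ e ⟧))
    ≡⟨ ∑-swap (coordinates n) (coordinates n) (λ x x′ → ⟦ x′ ℤ.≟ x ℤ.+ e ⟧) ⟩
  ∑ (coordinates n) (λ x′ → ∑ (coordinates n) (λ x → ⟦ x′ ℤ.≟ x ℤ.+ e ⟧))
    ≡⟨ ∑-cong (λ x′ → ∑-cong (λ x → ⟦⟧-cong (x′ ℤ.≟ x ℤ.+ e) (x ℤ.≟ x′ ℤ.+ +[1+ m ])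
         (λ { refl → lemma₁ x e }) (λ { refl → lemma₂ x′ e })) (coordinates n)) (coordinates n) ⟩
  ∑ (coordinates n) (λ x′ → ∑ (coordinates n) (λ x → ⟦ x ℤ.≟ x′ ℤ.+ +[1+ m ] ⟧))
    ≡⟨ ∑-cong (λ x′ → ∑-coordinates-≟ n (x′ ℤ.+ +[1+ m ])) (coordinates n) ⟩
  ∑ (coordinates n) (λ x′ → ⟦ range? n (x′ ℤ.+ +[1+ m ]) ⟧)
    ≡⟨ ∑-shifted-range n +[1+ m ] ⟩
  fromℕ (n ∸ suc m) ∎
  where
  open ≡-Reasoning
  lemma₁ : ∀ x e → x ≡ x ℤ.+ e ℤ.+ ℤ.- e
  lemma₁ = ℤSolver.solve-∀
  lemma₂ : ∀ x e → x ≡ x ℤ.+ ℤ.- e ℤ.+ e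
  lemma₂ = ℤSolver.solve-∀

-- Lexicographic positivity, because `board` lists its squares lexicographically. Of a nonzero move
-- and its negative, exactly one is positive.
Positive : ℤ × ℤ → Set
Positive (a , b) = 0ℤ ℤ.< a ⊎ (a ≡ 0ℤ × 0ℤ ℤ.< b)

Precedes : Position → Position → Set
Precedes (x , y) (x′ , y′) = Positive (x′ ℤ.- x , y′ ℤ.- y)

OnBoard : ℕ → Position → Set
OnBoard n (x , y) = Range n x × Range n y

<⇒0<- : ∀ {x y} → x ℤ.< y → 0ℤ ℤ.< y ℤ.- x
<⇒0<- {x} {y} x<y = subst (ℤ._< y ℤ.- x) (ℤ.+-inverseʳ x) (ℤ.+-monoˡ-< (ℤ.- x) x<y)

All-cartesianProduct : ∀ {P Q : ℤ → Set} {xs ys} → All P xs → All Q ys →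
  All (λ (x , y) → P x × Q y) (cartesianProduct xs ys)
All-cartesianProduct []         qys = []
All-cartesianProduct (px ∷ pxs) qys =
  All.++⁺ (All.map⁺ (All.map (px ,_) qys)) (All-cartesianProduct pxs qys)

cartesianProduct-precedes : ∀ {xs ys} → AllPairs ℤ._<_ xs → AllPairs ℤ._<_ ys →
  AllPairs Precedes (cartesianProduct xs ys)
cartesianProduct-precedes                 []            ys< = []
cartesianProduct-precedes {x ∷ xs} {ys} (x<xs ∷ xs<) ys< = AllPairs.++⁺
  (AllPairs.map⁺ (AllPairs.map (λ y<y′ → inj₂ (ℤ.+-inverseʳ x , <⇒0<- y<y′)) ys<))
  (cartesianProduct-precedes xs< ys<)
  (All.map⁺ (All.universal (λ y → All.map (λ (x<x′ , _) → inj₁ (<⇒0<- x<x′))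
    -- The condition on the second coordinates is the vacuous `0ℤ ≡ 0ℤ`: a larger first coordinate
    -- already decides.
    (All-cartesianProduct x<xs (All.universal (λ _ → refl {x = 0ℤ}) ys))) ys))

AllPairs-both : ∀ {A : Set} {P : A → Set} {xs} → All P xs → AllPairs (λ x y → P x × P y) xs
AllPairs-both []         = []
AllPairs-both (px ∷ pxs) = All.map (px ,_) pxs ∷ AllPairs-both pxs

board-onBoard : ∀ n → All (OnBoard n) (board n)
board-onBoard n = All-cartesianProduct (coordinates-range n) (coordinates-range n)

board-ordered : ∀ n → AllPairs (λ z z′ → Precedes z z′ × OnBoard n z × OnBoard n z′) (board n)
board-ordered n = AllPairs.zip
  ( cartesianProduct-precedes (coordinates-ascending n) (coordinates-ascending n)
  , AllPairs-both (board-onBoard n))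

scale : ℤ → ℤ × ℤ → ℤ × ℤ
scale k (c , d) = k ℤ.* c , k ℤ.* d

¬positive-zero : ¬ Positive (0ℤ , 0ℤ)
¬positive-zero (inj₁ (+<+ ()))
¬positive-zero (inj₂ (_ , +<+ ()))

positive-scale : ∀ k {v} → Positive v → Positive (scale +[1+ k ] v)
positive-scale k (inj₁ (+<+ {n = suc _} _))          = inj₁ (+<+ ℕ.z<s)
positive-scale k (inj₂ (refl , +<+ {n = suc _} _)) = inj₂ (ℤ.*-zeroʳ +[1+ k ] , +<+ ℕ.z<s)

positive-scale⁻¹ : ∀ k {v} → Positive v → Positive (scale k v) → ∃ λ k′ → k ≡ +[1+ k′ ]
positive-scale⁻¹ +[1+ k ] _   _   = k , refl
positive-scale⁻¹ (ℤ.+ 0)    _   pkv = contradiction pkv ¬positive-zero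
positive-scale⁻¹ -[1+ k ] (inj₁ (+<+ {n = suc _} _)) (inj₁ ())
positive-scale⁻¹ -[1+ k ] (inj₁ (+<+ {n = suc _} _)) (inj₂ (() , _))
positive-scale⁻¹ -[1+ k ] (inj₂ (refl , +<+ {n = suc _} _)) (inj₁ lt) =
  contradiction (subst (0ℤ ℤ.<_) (ℤ.*-zeroʳ -[1+ k ]) lt) λ { (+<+ ()) }
positive-scale⁻¹ -[1+ k ] (inj₂ (refl , +<+ {n = suc _} _)) (inj₂ (_ , ()))

positive-asym : ∀ {a b} → Positive (a , b) → ¬ Positive (ℤ.- a , ℤ.- b)
positive-asym (inj₁ (+<+ {n = suc _} _))        (inj₁ ())
positive-asym (inj₁ (+<+ {n = suc _} _))        (inj₂ (() , _))
positive-asym (inj₂ (refl , +<+ {n = suc _} _)) (inj₁ (+<+ ()))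
positive-asym (inj₂ (refl , +<+ {n = suc _} _)) (inj₂ (_ , ()))

precedes-irrefl : ∀ z → ¬ Precedes z z
precedes-irrefl (x , y) p = ¬positive-zero (subst₂ (λ a b → Positive (a , b)) (ℤ.+-inverseʳ x) (ℤ.+-inverseʳ y) p)

precedes-asym : ∀ z z′ → Precedes z z′ → ¬ Precedes z′ z
precedes-asym (x , y) (x′ , y′) p p′ = positive-asym p
  (subst₂ (λ a b → Positive (a , b)) (lemma x x′) (lemma y y′) p′)
  where
  lemma : ∀ x x′ → x ℤ.- x′ ≡ ℤ.- (x′ ℤ.- x)
  lemma = ℤSolver.solve-∀

positive-or-negative : ∀ c d → (c , d) ≢ (0ℤ , 0ℤ) → Positive (c , d) ⊎ Positive (ℤ.- c , ℤ.- d)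
positive-or-negative +[1+ c ] d        _    = inj₁ (inj₁ (+<+ ℕ.z<s))
positive-or-negative -[1+ c ] d        _    = inj₂ (inj₁ (+<+ ℕ.z<s))
positive-or-negative (ℤ.+ 0)    +[1+ d ] _    = inj₁ (inj₂ (refl , +<+ ℕ.z<s))
positive-or-negative (ℤ.+ 0)    -[1+ d ] _    = inj₂ (inj₂ (refl , +<+ ℕ.z<s))
positive-or-negative (ℤ.+ 0)    (ℤ.+ 0)    ≢0   = contradiction refl ≢0

-- Intervals are convex, and the middle point lies between x and the last point. This is the
-- downward closure that `∑<-initial` requires.
range-between : ∀ n x c k → Range n x → Range n (x ℤ.+ +[1+ suc k ] ℤ.* c) → Range n (x ℤ.+ +[1+ k ] ℤ.* c)
range-between n x (ℤ.+ c) k (0<x , _) (_ , x+≤n) =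
  ℤ.<-≤-trans 0<x (subst (ℤ._≤ x ℤ.+ +[1+ k ] ℤ.* ℤ.+ c) (ℤ.+-identityʳ x)
    (ℤ.+-monoʳ-≤ x (ℤ.*-monoʳ-≤-nonNeg (ℤ.+ c) (+≤+ {n = suc k} ℕ.z≤n)))) ,
  ℤ.≤-trans (ℤ.+-monoʳ-≤ x (ℤ.*-monoʳ-≤-nonNeg (ℤ.+ c) (+≤+ (ℕ.n≤1+n (suc k))))) x+≤n
range-between n x c@(-[1+ _ ]) k (_ , x≤n) (0<x+ , _) =
  ℤ.<-≤-trans 0<x+ (ℤ.+-monoʳ-≤ x (ℤ.*-monoʳ-≤-nonPos c (+≤+ (ℕ.n≤1+n (suc k))))) ,
  ℤ.≤-trans (subst (x ℤ.+ +[1+ k ] ℤ.* c ℤ.≤_) (ℤ.+-identityʳ x)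
    (ℤ.+-monoʳ-≤ x (ℤ.*-monoʳ-≤-nonPos c (+≤+ {n = suc k} ℕ.z≤n)))) x≤n

-- Squares ahead on the line of a square

module _ (m : ℤ × ℤ) (c d : ℤ) (v-positive : Positive (c , d))
  (to : ∀ z z′ → Attacks m z z′ → Attacks (c , d) z z′)
  (from : ∀ z z′ → Attacks (c , d) z z′ → Attacks m z z′) where

  open AttackClasses m

  -- The index k stands for `k + 1` moves. The positive vector `(c , d)`, which will be m or its
  -- negative, makes these moves run forward in the order of the board.
  step? : ∀ (z z′ : Position) k →
    Dec (proj₁ z′ ≡ proj₁ z ℤ.+ +[1+ k ] ℤ.* c × proj₂ z′ ≡ proj₂ z ℤ.+ +[1+ k ] ℤ.* d)
  step? (x , y) (x′ , y′) k =
    (x′ ℤ.≟ x ℤ.+ +[1+ k ] ℤ.* c) ×-dec (y′ ℤ.≟ y ℤ.+ +[1+ k ] ℤ.* d)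

  -- This serves as the F of `powers-ordered`: it detects attack in list order, is 0 in reverse
  -- order, and can be summed one coordinate at a time. The bound `k < n` loses nothing on the
  -- board, since every move raises the same coordinate by at least one.
  ahead : ℕ → Position → Position → ℚ
  ahead n z z′ = ∑< n (λ k → ⟦ step? z z′ k ⟧)

  difference : ∀ x x′ e → x′ ≡ x ℤ.+ e → x′ ℤ.- x ≡ e
  difference x x′ e refl = lemma x e
    where
    lemma : ∀ x e → x ℤ.+ e ℤ.- x ≡ e
    lemma = ℤSolver.solve-∀

  difference⁻¹ : ∀ x x′ e → x′ ℤ.- x ≡ e → x′ ≡ x ℤ.+ e
  difference⁻¹ x x′ _ refl = lemma x x′
    where
    lemma : ∀ x x′ → x′ ≡ x ℤ.+ (x′ ℤ.- x)
    lemma = ℤSolver.solve-∀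

  ahead-precedes : ∀ n z z′ → ¬ Precedes z z′ → ahead n z z′ ≡ 0ℚ
  ahead-precedes n z@(x , y) z′@(x′ , y′) ¬z<z′ = ∑<-zero n (λ k → ⟦⟧-no (step? z z′ k)
    (λ (eqx , eqy) → ¬z<z′ (subst₂ (λ a b → Positive (a , b))
      (sym (difference x x′ _ eqx)) (sym (difference y y′ _ eqy)) (positive-scale k v-positive))))

  scale-injective : ∀ {k l} → scale +[1+ k ] (c , d) ≡ scale +[1+ l ] (c , d) → k ≡ l
  scale-injective {k} {l} eq = cancel v-positive
    where
    cancel : Positive (c , d) → k ≡ l
    cancel (inj₁ (+<+ {n = suc _} _)) = ℤ.+[1+-injective (ℤ.*-cancelʳ-≡ _ _ c (cong proj₁ eq))
    cancel (inj₂ (_ , +<+ {n = suc _} _)) = ℤ.+[1+-injective (ℤ.*-cancelʳ-≡ _ _ d (cong proj₂ eq))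

  multiple-bound : ∀ n k e x x′ → 0ℤ ℤ.< e → Range n x → Range n x′ → x′ ℤ.- x ≡ +[1+ k ] ℤ.* e → k ℕ.< n
  multiple-bound n k e@(+[1+ e′ ]) x@(+[1+ _ ]) x′ _ _ (_ , x′≤n) eq = ℤ.drop‿+≤+ (begin
    +[1+ k ]           ≤⟨ +≤+ (ℕ.m≤m*n (suc k) (suc e′)) ⟩
    +[1+ k ] ℤ.* e     ≡⟨ eq ⟨
    x′ ℤ.- x           ≤⟨ ℤ.i≤j⇒i-k≤j x x′≤n ⟩
    ℤ.+ n              ∎)
    where open ℤ.≤-Reasoning
  multiple-bound n k +[1+ _ ] (ℤ.+ 0)    _ _        (+<+ () , _) _ _
  multiple-bound n k +[1+ _ ] -[1+ _ ] _ _        (() , _)     _ _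
  multiple-bound n k (ℤ.+ 0)    _        _ (+<+ ()) _            _ _

  attacks-ahead : ∀ n z z′ → Precedes z z′ → OnBoard n z → OnBoard n z′ →
    (a : Dec (Attacks m z z′)) → ⟦ a ⟧ ≡ ahead n z z′
  attacks-ahead n z@(x , y) z′@(x′ , y′) z<z′ (rx , ry) (rx′ , ry′) (yes a)
    with to z z′ a
  ... | k , eqx , eqy with positive-scale⁻¹ k v-positive (subst₂ (λ a b → Positive (a , b)) eqx eqy z<z′)
  ... | k′ , refl = sym (∑<-unique (step? z z′) (bound v-positive)
      (difference⁻¹ x x′ _ eqx , difference⁻¹ y y′ _ eqy)
      (λ l (eqx′ , eqy′) → scale-injective (cong₂ _,_
        (trans (sym (difference x x′ _ eqx′)) eqx) (trans (sym (difference y y′ _ eqy′)) eqy))))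
    where
    bound : Positive (c , d) → k′ ℕ.< n
    bound (inj₁ 0<c)       = multiple-bound n k′ c x x′ 0<c rx rx′ eqx
    bound (inj₂ (_ , 0<d)) = multiple-bound n k′ d y y′ 0<d ry ry′ eqy
  attacks-ahead n z@(x , y) z′@(x′ , y′) _ _ _ (no ¬a) = sym (∑<-zero n (λ k → ⟦⟧-no (step? z z′ k)
    (λ (eqx , eqy) → ¬a (from z z′ (+[1+ k ] , difference x x′ _ eqx , difference y y′ _ eqy)))))

  onward? : ∀ n (z : Position) k →
    Dec (Range n (proj₁ z ℤ.+ +[1+ k ] ℤ.* c) × Range n (proj₂ z ℤ.+ +[1+ k ] ℤ.* d))
  onward? n (x , y) k = range? n (x ℤ.+ +[1+ k ] ℤ.* c) ×-dec range? n (y ℤ.+ +[1+ k ] ℤ.* d)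

  ∑-ahead : ∀ n z → ∑ (board n) (ahead n z) ≡ ∑< n (λ k → ⟦ onward? n z k ⟧)
  ∑-ahead n z@(x , y) = trans (∑-∑<-swap (board n) n (λ z′ k → ⟦ step? z z′ k ⟧)) (∑<-cong n (λ k → begin
    ∑ (board n) (λ z′ → ⟦ step? z z′ k ⟧)
      ≡⟨ ∑-cong (λ (x′ , y′) → ⟦⟧-× (x′ ℤ.≟ x ℤ.+ +[1+ k ] ℤ.* c) (y′ ℤ.≟ y ℤ.+ +[1+ k ] ℤ.* d)) (board n) ⟩
    ∑ (board n) (λ (x′ , y′) → ⟦ x′ ℤ.≟ x ℤ.+ +[1+ k ] ℤ.* c ⟧ * ⟦ y′ ℤ.≟ y ℤ.+ +[1+ k ] ℤ.* d ⟧)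
      ≡⟨ ∑-cartesianProduct (coordinates n) (coordinates n) _ _ ⟩
    _ ≡⟨ cong₂ _*_ (∑-coordinates-≟ n (x ℤ.+ +[1+ k ] ℤ.* c)) (∑-coordinates-≟ n (y ℤ.+ +[1+ k ] ℤ.* d)) ⟩
    ⟦ range? n (x ℤ.+ +[1+ k ] ℤ.* c) ⟧ * ⟦ range? n (y ℤ.+ +[1+ k ] ℤ.* d) ⟧
      ≡⟨ ⟦⟧-× (range? n (x ℤ.+ +[1+ k ] ℤ.* c)) (range? n (y ℤ.+ +[1+ k ] ℤ.* d)) ⟨
    ⟦ onward? n z k ⟧ ∎))
    where open ≡-Reasoning

  -- The two coordinates are shifted independently, so the count is a product. The signs of c and d
  -- disappear here.
  ∑-onward : ∀ n k → ∑ (board n) (λ z → ⟦ onward? n z k ⟧) ≡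
    fromℕ (n ∸ suc k ℕ.* ∣ c ∣) * fromℕ (n ∸ suc k ℕ.* ∣ d ∣)
  ∑-onward n k = begin
    ∑ (board n) (λ z → ⟦ onward? n z k ⟧)
      ≡⟨ ∑-cong (λ (x , y) → ⟦⟧-× (range? n (x ℤ.+ +[1+ k ] ℤ.* c)) (range? n (y ℤ.+ +[1+ k ] ℤ.* d))) (board n) ⟩
    ∑ (board n) (λ (x , y) → ⟦ range? n (x ℤ.+ +[1+ k ] ℤ.* c) ⟧ * ⟦ range? n (y ℤ.+ +[1+ k ] ℤ.* d) ⟧)
      ≡⟨ ∑-cartesianProduct (coordinates n) (coordinates n) _ _ ⟩
    _ ≡⟨ cong₂ _*_ (∑-shifted-range n (+[1+ k ] ℤ.* c)) (∑-shifted-range n (+[1+ k ] ℤ.* d)) ⟩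
    fromℕ (n ∸ ∣ +[1+ k ] ℤ.* c ∣) * fromℕ (n ∸ ∣ +[1+ k ] ℤ.* d ∣)
      ≡⟨ cong₂ (λ e f → fromℕ (n ∸ e) * fromℕ (n ∸ f)) (ℤ.abs-* +[1+ k ] c) (ℤ.abs-* +[1+ k ] d) ⟩
    fromℕ (n ∸ suc k ℕ.* ∣ c ∣) * fromℕ (n ∸ suc k ℕ.* ∣ d ∣) ∎
    where open ≡-Reasoning

  -- The contribution `Ω` of a square depends on how many squares lie ahead of it. Those correspond
  -- to an initial segment of k, so `Ω` expands by its increments. Exchanging the sums leaves, for
  -- each k, the number of squares from which `k + 1` moves stay on the board. The term
  -- `fromℕ n * fromℕ n` is `Ω 0ℚ`, which is 1, summed over the board.
  board-powers-oriented : ∀ n i → powers (board n) i ≡ fromℕ n * fromℕ n +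
    ∑< n (λ k → fromℕ (n ∸ suc k ℕ.* ∣ c ∣) * fromℕ (n ∸ suc k ℕ.* ∣ d ∣) * second-difference (suc i) (fromℕ k))
  board-powers-oriented n i = begin
    powers (board n) i
      ≡⟨ powers-ordered i (ahead n) (λ z → ahead-precedes n z z (precedes-irrefl z))
           (AllPairs.map (λ {z} {z′} (z<z′ , bz , bz′) →
             attacks-ahead n z z′ z<z′ bz bz′ (attacks? m z z′) ,
             ahead-precedes n z′ z (precedes-asym z z′ z<z′)) (board-ordered n)) ⟩
    ∑ (board n) (λ z → Ω (∑ (board n) (ahead n z)))
      ≡⟨ ∑-cong-All (All.map (λ {z} → expand z) (board-onBoard n)) ⟩
    ∑ (board n) (λ z → 1ℚ * 1ℚ + ∑< n (λ k → ⟦ onward? n z k ⟧ * second-difference (suc i) (fromℕ k)))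
      ≡⟨ ∑-+ (board n) (λ _ → 1ℚ * 1ℚ) (λ z → ∑< n (λ k → ⟦ onward? n z k ⟧ * second-difference (suc i) (fromℕ k))) ⟩
    ∑ (board n) (λ _ → 1ℚ * 1ℚ)
      + ∑ (board n) (λ z → ∑< n (λ k → ⟦ onward? n z k ⟧ * second-difference (suc i) (fromℕ k)))
      ≡⟨ cong₂ _+_
           (trans (∑-cartesianProduct (coordinates n) (coordinates n) (λ _ → 1ℚ) (λ _ → 1ℚ))
             (cong₂ _*_ length-coordinates length-coordinates))
           (trans (∑-∑<-swap (board n) n (λ z k → ⟦ onward? n z k ⟧ * second-difference (suc i) (fromℕ k)))
             (∑<-cong n (λ k → trans
               (∑-*ʳ (board n) (second-difference (suc i) (fromℕ k)) (λ z → ⟦ onward? n z k ⟧))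
               (cong (_* second-difference (suc i) (fromℕ k)) (∑-onward n k))))) ⟩
    fromℕ n * fromℕ n +
      ∑< n (λ k → fromℕ (n ∸ suc k ℕ.* ∣ c ∣) * fromℕ (n ∸ suc k ℕ.* ∣ d ∣) * second-difference (suc i) (fromℕ k)) ∎
    where
    open ≡-Reasoning
    Ω : ℚ → ℚ
    Ω s = (1ℚ + s) ^ suc i - s ^ suc i
    length-coordinates : ∑ (coordinates n) (λ _ → 1ℚ) ≡ fromℕ n
    length-coordinates = trans (∑-coordinates n (λ _ → 1ℚ))
      (trans (∑<-cong-< n (λ k k<n → sym (⟦⟧-yes (k ℕ.<? n) k<n))) (∑<-below {n} ℕ.≤-refl))
    Ω0≡1 : Ω 0ℚ ≡ 1ℚ * 1ℚ
    Ω0≡1 = cong₂ _-_ (1^ (suc i)) (0^ i)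
    expand : ∀ z → OnBoard n z →
      Ω (∑ (board n) (ahead n z)) ≡ 1ℚ * 1ℚ + ∑< n (λ k → ⟦ onward? n z k ⟧ * second-difference (suc i) (fromℕ k))
    expand z@(x , y) (rx , ry) = begin
      Ω (∑ (board n) (ahead n z))              ≡⟨ cong Ω (∑-ahead n z) ⟩
      Ω (∑< n (λ k → ⟦ onward? n z k ⟧))
        ≡⟨ ∑<-initial Ω n (onward? n z)
             (λ k (rx′ , ry′) → range-between n x c k rx rx′ , range-between n y d k ry ry′) ⟩
      Ω 0ℚ + ∑< n (λ k → ⟦ onward? n z k ⟧ * second-difference (suc i) (fromℕ k))
        ≡⟨ cong (_+ ∑< n (λ k → ⟦ onward? n z k ⟧ * second-difference (suc i) (fromℕ k))) Ω0≡1 ⟩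
      1ℚ * 1ℚ + ∑< n (λ k → ⟦ onward? n z k ⟧ * second-difference (suc i) (fromℕ k)) ∎

-- Closed form of the moments

δ : (ℚ → ℚ) → ℚ → ℚ
δ H x = H (1ℚ + x) - H x

powerSum-suc : ∀ m x → powerSum m (1ℚ + x) ≡ powerSum m x + x ^ m
powerSum-suc m x = trans (cong (powerSum m) (ℚ.+-comm 1ℚ x))
  (trans (lemma (powerSum m (x + 1ℚ)) (powerSum m x)) (cong (λ z → powerSum m x + z) (powerSum-Δ m x)))
  where
  lemma : ∀ a b → a ≡ b + (a - b)
  lemma = solve-∀ ℚ-ring

δδ-summed-w : ∀ m x → δ (summed-w m) (1ℚ + x) ≡ δ (summed-w m) x + second-difference m x
δδ-summed-w m x = lemma x (x ^ m) ((1ℚ + x) ^ m) ((1ℚ + (1ℚ + x)) ^ m)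
  where
  lemma : ∀ x a b c → c - (1ℚ + (1ℚ + x)) - (b - (1ℚ + x)) ≡ b - (1ℚ + x) - (a - x) + (c - b - (b - a))
  lemma = solve-∀ ℚ-ring

-- The second difference of `t * t ^ m` exceeds the wanted `(1ℚ + x) * second-difference m x` by
-- `x₂ - x₀`. That excess is the second difference of `t ^ m + 2 * powerSum m t`, which explains the
-- subtracted terms of `summed-kw`.
δδ-summed-kw : ∀ m x → δ (summed-kw m) (1ℚ + x) ≡ δ (summed-kw m) x + (1ℚ + x) * second-difference m x
δδ-summed-kw m x = begin
  kw (1ℚ + (1ℚ + x)) x₂ s₂ - kw (1ℚ + x) x₁ s₁
    ≡⟨ cong₂ (λ s t → kw (1ℚ + (1ℚ + x)) x₂ t - kw (1ℚ + x) x₁ s) s₁≡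
         (trans (powerSum-suc m (1ℚ + x)) (cong (λ z → z + x₁) s₁≡)) ⟩
  kw (1ℚ + (1ℚ + x)) x₂ (s₀ + x₀ + x₁) - kw (1ℚ + x) x₁ (s₀ + x₀)
    ≡⟨ lemma x x₀ x₁ x₂ s₀ ⟩
  kw (1ℚ + x) x₁ (s₀ + x₀) - kw x x₀ s₀ + (1ℚ + x) * (x₂ - x₁ - (x₁ - x₀))
    ≡⟨ cong (λ s → kw (1ℚ + x) x₁ s - kw x x₀ s₀ + (1ℚ + x) * (x₂ - x₁ - (x₁ - x₀))) s₁≡ ⟨
  kw (1ℚ + x) x₁ s₁ - kw x x₀ s₀ + (1ℚ + x) * (x₂ - x₁ - (x₁ - x₀)) ∎
  where
  open ≡-Reasoning
  x₀ = x ^ m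
  x₁ = (1ℚ + x) ^ m
  x₂ = (1ℚ + (1ℚ + x)) ^ m
  s₀ = powerSum m x
  s₁ = powerSum m (1ℚ + x)
  s₂ = powerSum m (1ℚ + (1ℚ + x))
  s₁≡ : s₁ ≡ s₀ + x₀
  s₁≡ = powerSum-suc m x
  kw : ℚ → ℚ → ℚ → ℚ
  kw x p s = x * p - p - (1ℚ + 1ℚ) * s
  lemma : ∀ x x₀ x₁ x₂ s →
    ((1ℚ + (1ℚ + x)) * x₂ - x₂ - (1ℚ + 1ℚ) * (s + x₀ + x₁)) - ((1ℚ + x) * x₁ - x₁ - (1ℚ + 1ℚ) * (s + x₀)) ≡
    ((1ℚ + x) * x₁ - x₁ - (1ℚ + 1ℚ) * (s + x₀)) - (x * x₀ - x₀ - (1ℚ + 1ℚ) * s) + (1ℚ + x) * (x₂ - x₁ - (x₁ - x₀))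
  lemma = solve-∀ ℚ-ring

-- A second difference leaves a linear function undetermined. The values 0 at 0 and 1 fix it and
-- remove the boundary terms of `weighted-sum` at `t = 0`.
summed-w-0 : ∀ m → summed-w (suc m) 0ℚ ≡ 0ℚ
summed-w-0 m = cong (λ z → z - 0ℚ) (0^ m)

summed-w-1 : ∀ m → summed-w m (1ℚ + 0ℚ) ≡ 0ℚ
summed-w-1 m = cong (λ z → z - 1ℚ) (1^ m)

summed-kw-0 : ∀ m → summed-kw (suc m) 0ℚ ≡ 0ℚ
summed-kw-0 m = cong₂ _-_ (cong₂ _-_ (0^ (suc m)) (0^ m)) (cong (λ z → (1ℚ + 1ℚ) * z) (powerSum-0 (suc m)))

summed-kw-1 : ∀ m → summed-kw (suc m) (1ℚ + 0ℚ) ≡ 0ℚ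
summed-kw-1 m = cong₂ _-_ (cong₂ _-_ (1^ (suc (suc m))) (1^ (suc m)))
  (cong (λ z → (1ℚ + 1ℚ) * z)
    (trans (powerSum-suc (suc m) 0ℚ) (cong₂ _+_ (powerSum-0 (suc m)) (0^ m))))

-- Abel summation, for x independent of t.
weighted-sum : ∀ a b x m t →
  ∑< t (λ k → (x - (1ℚ + fromℕ k) * a) * (x - (1ℚ + fromℕ k) * b) * second-difference (suc m) (fromℕ k)) ≡
  x * ((x - fromℕ t * b) * δ (summed-w (suc m)) (fromℕ t) + b * summed-w (suc m) (fromℕ t))
  - a * ((x - fromℕ t * b) * δ (summed-kw (suc m)) (fromℕ t) + b * summed-kw (suc m) (fromℕ t))
weighted-sum a b x m zero = sym (trans
  (cong₂ (λ (w₀ , w₁) (k₀ , k₁) →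
      x * ((x - 0ℚ * b) * (w₁ - w₀) + b * w₀) - a * ((x - 0ℚ * b) * (k₁ - k₀) + b * k₀))
    (cong₂ _,_ (summed-w-0 m) (summed-w-1 (suc m))) (cong₂ _,_ (summed-kw-0 m) (summed-kw-1 m)))
  (lemma a b x))
  where
  lemma : ∀ a b x → x * ((x - 0ℚ * b) * 0ℚ + b * 0ℚ) - a * ((x - 0ℚ * b) * 0ℚ + b * 0ℚ) ≡ 0ℚ
  lemma = solve-∀ ℚ-ring
weighted-sum a b x m (suc t) = begin
  ∑< (suc t) f
    ≡⟨ ∑<-last t f ⟩
  ∑< t f + f t
    ≡⟨ cong (λ z → z + f t) (weighted-sum a b x m t) ⟩
  x * ((x - T * b) * δ Hw T + b * Hw T) - a * ((x - T * b) * δ Hkw T + b * Hkw T) + f t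
    ≡⟨ lemma a b x T (Hw T) (Hw (1ℚ + T)) (Hkw T) (Hkw (1ℚ + T)) (second-difference (suc m) T) ⟩
  x * ((x - (1ℚ + T) * b) * (δ Hw T + second-difference (suc m) T) + b * Hw (1ℚ + T))
  - a * ((x - (1ℚ + T) * b) * (δ Hkw T + (1ℚ + T) * second-difference (suc m) T) + b * Hkw (1ℚ + T))
    ≡⟨ cong₂ (λ w k →
           x * ((x - (1ℚ + T) * b) * w + b * Hw (1ℚ + T)) - a * ((x - (1ℚ + T) * b) * k + b * Hkw (1ℚ + T)))
         (δδ-summed-w (suc m) T) (δδ-summed-kw (suc m) T) ⟨
  x * ((x - (1ℚ + T) * b) * δ Hw (1ℚ + T) + b * Hw (1ℚ + T))
  - a * ((x - (1ℚ + T) * b) * δ Hkw (1ℚ + T) + b * Hkw (1ℚ + T))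
    ≡⟨ cong (λ s → x * ((x - s * b) * δ Hw s + b * Hw s) - a * ((x - s * b) * δ Hkw s + b * Hkw s)) (fromℕ-suc t) ⟨
  x * ((x - fromℕ (suc t) * b) * δ Hw (fromℕ (suc t)) + b * Hw (fromℕ (suc t)))
  - a * ((x - fromℕ (suc t) * b) * δ Hkw (fromℕ (suc t)) + b * Hkw (fromℕ (suc t))) ∎
  where
  open ≡-Reasoning
  T   = fromℕ t
  Hw  = summed-w (suc m)
  Hkw = summed-kw (suc m)
  f : ℕ → ℚ
  f k = (x - (1ℚ + fromℕ k) * a) * (x - (1ℚ + fromℕ k) * b) * second-difference (suc m) (fromℕ k)
  lemma : ∀ a b x T w₀ w₁ k₀ k₁ W →
    x * ((x - T * b) * (w₁ - w₀) + b * w₀) - a * ((x - T * b) * (k₁ - k₀) + b * k₀)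
      + (x - (1ℚ + T) * a) * (x - (1ℚ + T) * b) * W ≡
    x * ((x - (1ℚ + T) * b) * (w₁ - w₀ + W) + b * w₁)
      - a * ((x - (1ℚ + T) * b) * (k₁ - k₀ + (1ℚ + T) * W) + b * k₁)
  lemma = solve-∀ ℚ-ring

-- Here the interpolants arise: for `x = b * (t + θ)` the boundary factor `x - t * b` is `b * θ`,
-- and `b * θ * δ H t + b * H t` is b times the linear interpolant of H at `t + θ`. For index 0 the
-- weights are second differences of a linear function and vanish.
moment-sum : ∀ a b θ i t → let x = b * (fromℕ t + θ) in
  x * x + ∑< t (λ k → (x - (1ℚ + fromℕ k) * a) * (x - (1ℚ + fromℕ k) * b) * second-difference (suc i) (fromℕ k))
  ≡ moment a b θ i (fromℕ t + θ)
moment-sum a b θ zero t = trans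
  (cong (λ z → x * x + z) (∑<-zero t (λ k → trans
    (cong (λ z → (x - (1ℚ + fromℕ k) * a) * (x - (1ℚ + fromℕ k) * b) * z) (lemma (fromℕ k)))
    (ℚ.*-zeroʳ ((x - (1ℚ + fromℕ k) * a) * (x - (1ℚ + fromℕ k) * b))))))
  (+-identityʳ (x * x))
  where
  x = b * (fromℕ t + θ)
  lemma : ∀ k → (1ℚ + (1ℚ + k)) * 1ℚ - (1ℚ + k) * 1ℚ - ((1ℚ + k) * 1ℚ - k * 1ℚ) ≡ 0ℚ
  lemma = solve-∀ ℚ-ring
moment-sum a b θ (suc i) t = begin
  x * x + ∑< t (λ k → (x - (1ℚ + fromℕ k) * a) * (x - (1ℚ + fromℕ k) * b) * second-difference (suc (suc i)) (fromℕ k))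
    ≡⟨ cong (λ z → x * x + z) (weighted-sum a b x (suc i) t) ⟩
  x * x + (x * ((x - T * b) * δ Hw T + b * Hw T) - a * ((x - T * b) * δ Hkw T + b * Hkw T))
    ≡⟨ lemma a b T θ (Hw T) (Hw (1ℚ + T)) (Hkw T) (Hkw (1ℚ + T)) ⟩
  x * x + b * (x * ((1ℚ - θ) * Hw T + θ * Hw (1ℚ + T)) - a * ((1ℚ - θ) * Hkw T + θ * Hkw (1ℚ + T)))
    ≡⟨ cong (λ s → x * x + b * (x * ((1ℚ - θ) * Hw T + θ * Hw s) - a * ((1ℚ - θ) * Hkw T + θ * Hkw s)))
         (ℚ.+-comm 1ℚ T) ⟩
  x * x + b * (x * interpolate θ Hw T - a * interpolate θ Hkw T)
    ≡⟨ cong (λ s → x * x + b * (x * interpolate θ Hw s - a * interpolate θ Hkw s)) (lemma₂ T θ) ⟩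
  moment a b θ (suc i) (T + θ) ∎
  where
  open ≡-Reasoning
  T   = fromℕ t
  x   = b * (T + θ)
  Hw  = summed-w (suc (suc i))
  Hkw = summed-kw (suc (suc i))
  lemma : ∀ a b T θ w₀ w₁ k₀ k₁ →
    b * (T + θ) * (b * (T + θ)) +
      (b * (T + θ) * ((b * (T + θ) - T * b) * (w₁ - w₀) + b * w₀)
        - a * ((b * (T + θ) - T * b) * (k₁ - k₀) + b * k₀)) ≡
    b * (T + θ) * (b * (T + θ)) +
      b * (b * (T + θ) * ((1ℚ - θ) * w₀ + θ * w₁) - a * ((1ℚ - θ) * k₀ + θ * k₁))
  lemma = solve-∀ ℚ-ring
  lemma₂ : ∀ T θ → T ≡ T + θ - θ
  lemma₂ = solve-∀ ℚ-ring

fromℕ-∸ : ∀ {m n} → m ℕ.≤ n → fromℕ (n ∸ m) ≡ fromℕ n - fromℕ m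
fromℕ-∸ {m} {n} m≤n = trans (lemma (fromℕ (n ∸ m)) (fromℕ m))
  (cong (λ z → z - fromℕ m) (trans (sym (fromℕ-homo-+ (n ∸ m) m)) (cong fromℕ (ℕ.m∸n+n≡m m≤n))))
  where
  lemma : ∀ x y → x ≡ x + y - y
  lemma = solve-∀ ℚ-ring

module _ (b : ℕ) .{{_ : ℕ.NonZero b}} where

  fraction : ℕ → ℚ
  fraction r = fromℕ r * recip b

  b*fraction : ∀ r → fromℕ b * fraction r ≡ fromℕ r
  b*fraction r = trans (lemma (fromℕ b) (fromℕ r) (recip b))
    (trans (cong (λ z → fromℕ r * z) (fromℕ-*-recip b)) (*-identityʳ (fromℕ r)))
    where
    lemma : ∀ b r s → b * (r * s) ≡ r * (b * s)
    lemma = solve-∀ ℚ-ring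

  fromℕ-quotient : ∀ t r → fromℕ (b ℕ.* t ℕ.+ r) ≡ fromℕ b * (fromℕ t + fraction r)
  fromℕ-quotient t r = begin
    fromℕ (b ℕ.* t ℕ.+ r)                       ≡⟨ fromℕ-homo-+ (b ℕ.* t) r ⟩
    fromℕ (b ℕ.* t) + fromℕ r                   ≡⟨ cong₂ _+_ (fromℕ-homo-* b t) (sym (b*fraction r)) ⟩
    fromℕ b * fromℕ t + fromℕ b * fraction r    ≡⟨ ℚ.*-distribˡ-+ (fromℕ b) (fromℕ t) (fraction r) ⟨
    fromℕ b * (fromℕ t + fraction r)            ∎
    where open ≡-Reasoning

  -- The factor with b decides the truncation: it is 0 from `k = t` on, because `r ≤ b`. For `k < t`
  -- it is a true difference, and so is the factor with a, because `a ≤ b`.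
  truncated-moment : ∀ {a} → a ℕ.≤ b → ∀ t r → r ℕ.≤ b → ∀ i → let n = b ℕ.* t ℕ.+ r in
    fromℕ n * fromℕ n +
      ∑< n (λ k → fromℕ (n ∸ suc k ℕ.* a) * fromℕ (n ∸ suc k ℕ.* b) * second-difference (suc i) (fromℕ k))
    ≡ moment (fromℕ a) (fromℕ b) (fraction r) i (fromℕ t + fraction r)
  truncated-moment {a} a≤b t r r≤b i = trans
    (cong (λ z → x * x + z) (trans (∑<-truncate f t≤n beyond) (∑<-cong-< t within)))
    (trans (cong (λ x → x * x + ∑< t (λ k →
        (x - (1ℚ + fromℕ k) * fromℕ a) * (x - (1ℚ + fromℕ k) * fromℕ b) * second-difference (suc i) (fromℕ k)))
        (fromℕ-quotient t r))
      (moment-sum (fromℕ a) (fromℕ b) (fraction r) i t))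
    where
    n = b ℕ.* t ℕ.+ r
    x = fromℕ n
    f : ℕ → ℚ
    f k = fromℕ (n ∸ suc k ℕ.* a) * fromℕ (n ∸ suc k ℕ.* b) * second-difference (suc i) (fromℕ k)
    t≤n : t ℕ.≤ n
    t≤n = ℕ.≤-trans (ℕ.m≤n*m t b) (ℕ.m≤m+n (b ℕ.* t) r)
    beyond : ∀ k → t ℕ.≤ k → f k ≡ 0ℚ
    beyond k t≤k = trans
      (cong (λ z → fromℕ (n ∸ suc k ℕ.* a) * fromℕ z * second-difference (suc i) (fromℕ k)) (ℕ.m≤n⇒m∸n≡0 n≤))
      (lemma (fromℕ (n ∸ suc k ℕ.* a)) (second-difference (suc i) (fromℕ k)))
      where
      lemma : ∀ x y → x * 0ℚ * y ≡ 0ℚ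
      lemma = solve-∀ ℚ-ring
      n≤ : n ℕ.≤ suc k ℕ.* b
      n≤ = begin
        b ℕ.* t ℕ.+ r   ≤⟨ ℕ.+-mono-≤ (ℕ.*-monoʳ-≤ b t≤k) r≤b ⟩
        b ℕ.* k ℕ.+ b   ≡⟨ trans (ℕ.+-comm (b ℕ.* k) b) (cong (b ℕ.+_) (ℕ.*-comm b k)) ⟩
        suc k ℕ.* b     ∎
        where open ℕ.≤-Reasoning
    within : ∀ k → k ℕ.< t →
      f k ≡ (x - (1ℚ + fromℕ k) * fromℕ a) * (x - (1ℚ + fromℕ k) * fromℕ b) * second-difference (suc i) (fromℕ k)
    within k k<t = cong₂ (λ y z → y * z * second-difference (suc i) (fromℕ k))
      (shortened a (ℕ.≤-trans (ℕ.*-monoʳ-≤ (suc k) a≤b) kb≤n)) (shortened b kb≤n)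
      where
      kb≤n : suc k ℕ.* b ℕ.≤ n
      kb≤n = ℕ.≤-trans (ℕ.*-monoˡ-≤ b k<t) (subst (ℕ._≤ n) (ℕ.*-comm b t) (ℕ.m≤m+n (b ℕ.* t) r))
      shortened : ∀ e → suc k ℕ.* e ℕ.≤ n → fromℕ (n ∸ suc k ℕ.* e) ≡ x - (1ℚ + fromℕ k) * fromℕ e
      shortened e ke≤n = trans (fromℕ-∸ ke≤n)
        (cong (λ z → x - z) (trans (fromℕ-homo-* (suc k) e) (cong (λ z → z * fromℕ e) (fromℕ-suc k))))

mutual
  elementary-cong : ∀ {p p′} → (∀ i → p i ≡ p′ i) → ∀ q → elementary p q ≡ elementary p′ q
  elementary-cong eq zero    = refl
  elementary-cong eq (suc q) = cong (λ z → recip (suc q) * z) (marked-cong eq q 0)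

  marked-cong : ∀ {p p′} → (∀ i → p i ≡ p′ i) → ∀ q i → marked p q i ≡ marked p′ q i
  marked-cong eq zero    i = eq i
  marked-cong eq (suc q) i =
    cong₂ _-_ (cong₂ _*_ (eq i) (elementary-cong eq (suc q))) (marked-cong eq q (suc i))

-- The period

attacks-negate : ∀ c d z z′ → Attacks (c , d) z z′ → Attacks (ℤ.- c , ℤ.- d) z z′
attacks-negate c d z z′ (k , x≡ , y≡) = ℤ.- k , trans x≡ (lemma k c) , trans y≡ (lemma k d)
  where
  lemma : ∀ k c → k ℤ.* c ≡ ℤ.- k ℤ.* ℤ.- c
  lemma = ℤSolver.solve-∀

attacks-negate⁻¹ : ∀ c d z z′ → Attacks (ℤ.- c , ℤ.- d) z z′ → Attacks (c , d) z z′
attacks-negate⁻¹ c d z z′ (k , x≡ , y≡) = ℤ.- k , trans x≡ (lemma k c) , trans y≡ (lemma k d)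
  where
  lemma : ∀ k c → k ℤ.* ℤ.- c ≡ ℤ.- k ℤ.* c
  lemma = ℤSolver.solve-∀

module _ (c d : ℤ) where

  board-powers : (c , d) ≢ (0ℤ , 0ℤ) → ∀ n i →
    AttackClasses.powers (c , d) (board n) i ≡ fromℕ n * fromℕ n +
    ∑< n (λ k → fromℕ (n ∸ suc k ℕ.* ∣ c ∣) * fromℕ (n ∸ suc k ℕ.* ∣ d ∣) * second-difference (suc i) (fromℕ k))
  board-powers ≢0 n i with positive-or-negative c d ≢0
  ... | inj₁ v>0 = board-powers-oriented (c , d) c d v>0 (λ _ _ → id) (λ _ _ → id) n i
  ... | inj₂ v<0 = subst₂ (λ e f → AttackClasses.powers (c , d) (board n) i ≡ fromℕ n * fromℕ n +
      ∑< n (λ k → fromℕ (n ∸ suc k ℕ.* e) * fromℕ (n ∸ suc k ℕ.* f) * second-difference (suc i) (fromℕ k)))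
    (ℤ.∣-i∣≡∣i∣ c) (ℤ.∣-i∣≡∣i∣ d)
    (board-powers-oriented (c , d) (ℤ.- c) (ℤ.- d) v<0 (attacks-negate c d) (attacks-negate⁻¹ c d) n i)

module Period (c d : ℤ) (≢0 : (c , d) ≢ (0ℤ , 0ℤ)) {a b : ℕ} (a≤b : a ℕ.≤ b) .{{_ : ℕ.NonZero b}}
  (sides : ∀ (F : ℕ → ℚ) → F ∣ c ∣ * F ∣ d ∣ ≡ F a * F b) where

  frac : ℕ → ℚ
  frac = fraction b

  -- The count as a function of `y = n / b`, with the residue r of n present only as the parameter
  -- `θ = r / b`. This permits comparing two residues at the same y.
  curve : ℕ → ℚ → ℚ → ℚ
  curve q θ y = elementary (λ i → moment (fromℕ a) (fromℕ b) θ i y) q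

  curve-deg : ∀ q θ → Deg≤ (double q) (curve q θ)
  curve-deg q θ = elementary-deg (moment (fromℕ a) (fromℕ b) θ) (moment-deg (fromℕ a) (fromℕ b) θ) q

  u-curve : ∀ q t r → r ℕ.≤ b → fromℕ (u (c , d) q (b ℕ.* t ℕ.+ r)) ≡ curve q (frac r) (fromℕ t + frac r)
  u-curve q t r r≤b = trans (AttackClasses.count≡elementary (c , d) q (board n)) (elementary-cong (λ i → begin
    AttackClasses.powers (c , d) (board n) i
      ≡⟨ board-powers c d ≢0 n i ⟩
    fromℕ n * fromℕ n +
      ∑< n (λ k → fromℕ (n ∸ suc k ℕ.* ∣ c ∣) * fromℕ (n ∸ suc k ℕ.* ∣ d ∣) * second-difference (suc i) (fromℕ k))
      ≡⟨ cong (λ z → fromℕ n * fromℕ n + z) (∑<-cong n (λ k →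
           cong (λ z → z * second-difference (suc i) (fromℕ k)) (sides (λ e → fromℕ (n ∸ suc k ℕ.* e))))) ⟩
    fromℕ n * fromℕ n +
      ∑< n (λ k → fromℕ (n ∸ suc k ℕ.* a) * fromℕ (n ∸ suc k ℕ.* b) * second-difference (suc i) (fromℕ k))
      ≡⟨ truncated-moment b a≤b t r r≤b i ⟩
    moment (fromℕ a) (fromℕ b) (frac r) i (fromℕ t + frac r) ∎) q)
    where
    open ≡-Reasoning
    n = b ℕ.* t ℕ.+ r

  quasipolynomial : ∀ q → QuasipolynomialMod (u (c , d) q) b
  quasipolynomial q = (λ ρ → proj₁ (poly (Fin.toℕ ρ))) , λ n _ → begin
    fromℕ (u (c , d) q n)
      ≡⟨ cong (fromℕ ∘ u (c , d) q) (n≡ n) ⟩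
    fromℕ (u (c , d) q (b ℕ.* (n ℕ./ b) ℕ.+ res n))
      ≡⟨ u-curve q (n ℕ./ b) (res n) (ℕ.<⇒≤ (Fin.toℕ<n (n mod b))) ⟩
    curve q (frac (res n)) (fromℕ (n ℕ./ b) + frac (res n))
      ≡⟨ cong (curve q (frac (res n))) (y≡ n) ⟩
    curve q (frac (res n)) (fromℕ n * recip b)
      ≡⟨ proj₂ (poly (res n)) (fromℕ n) ⟩
    eval (proj₁ (poly (res n))) (fromℕ n) ∎
    where
    open ≡-Reasoning
    res : ℕ → ℕ
    res n = Fin.toℕ (n mod b)
    poly : ∀ r → Σ Polynomial λ g → ∀ x → curve q (frac r) (x * recip b) ≡ eval g x
    poly r = lead⇒polynomial (double q) (proj₂ (lead-dilate (double q) (recip b) (proj₂ (curve-deg q (frac r)))))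
    n≡ : ∀ n → n ≡ b ℕ.* (n ℕ./ b) ℕ.+ res n
    n≡ n = trans (ℕ.m≡m%n+[m/n]*n n b) (trans (ℕ.+-comm (n ℕ.% b) _)
      (cong₂ ℕ._+_ (ℕ.*-comm (n ℕ./ b) b) (sym (Fin.toℕ-fromℕ< (ℕ.m%n<n n b)))))
    lemma : ∀ b s y → b * s ≡ 1ℚ → y ≡ b * y * s
    lemma b s y bs≡1 = trans (sym (*-identityˡ y)) (trans (cong (λ z → z * y) (sym bs≡1)) (lemma′ b s y))
      where
      lemma′ : ∀ b s y → b * s * y ≡ b * y * s
      lemma′ = solve-∀ ℚ-ring
    y≡ : ∀ n → fromℕ (n ℕ./ b) + frac (res n) ≡ fromℕ n * recip b
    y≡ n = trans (lemma (fromℕ b) (recip b) _ (fromℕ-*-recip b))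
      (cong (λ z → z * recip b) (trans (sym (fromℕ-quotient b (n ℕ./ b) (res n))) (cong fromℕ (sym (n≡ n)))))

  module _ (a<b : 1 ℕ.< b → a ℕ.< b) where

    -- The moments for θ lie above those for 0 in the decisive coefficient, so the placement counts
    -- lie below. Identical curves would make that positive coefficient vanish.
    curves-distinct : ∀ q r → 0 ℕ.< r → r ℕ.< b →
      ¬ (∀ y → curve (suc (suc q)) 0ℚ y ≡ curve (suc (suc q)) (frac r) y)
    curves-distinct q r 0<r r<b same =
      let κ , 0<κ , l = elementary-difference-positive (moment aℚ bℚ 0ℚ) (moment aℚ bℚ θ)
            (moment-deg aℚ bℚ 0ℚ) (moment-deg aℚ bℚ θ)
            (bℚ * bℚ , *-positive 0<bℚ 0<bℚ , square-lead aℚ bℚ) (λ _ → refl)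
            (λ i → _ , moment-difference-lead aℚ bℚ θ i)
            -- From `0 < r` and `r < b` it follows that `1 < b`, so `a<b` applies, and also that θ
            -- lies strictly between 0 and 1.
            (bℚ * (bℚ - aℚ) * (θ * (1ℚ - θ)) ,
             *-positive (*-positive 0<bℚ (0<- (fromℕ-mono-< (a<b (ℕ.≤-<-trans 0<r r<b))))) (*-positive 0<θ 0<1-θ) ,
             moment-difference-lead₁ aℚ bℚ θ)
            q
          κ≡0 , _ = vanishing (suc (double q)) fromℕ fromℕ-injective l
            (λ i → trans (cong (λ z → z - curve (suc (suc q)) θ (fromℕ i)) (same (fromℕ i)))
                         (ℚ.+-inverseʳ (curve (suc (suc q)) θ (fromℕ i))))
      in ℚ.<-irrefl (sym κ≡0) 0<κ
      where
      aℚ = fromℕ a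
      bℚ = fromℕ b
      θ = frac r
      0<- : ∀ {x y} → x ℚ.< y → 0ℚ ℚ.< y - x
      0<- {x} {y} x<y = subst (ℚ._< y - x) (ℚ.+-inverseʳ x) (ℚ.+-monoˡ-< (ℚ.- x) x<y)
      0<bℚ : 0ℚ ℚ.< bℚ
      0<bℚ = fromℕ-mono-< (ℕ.<-trans 0<r r<b)
      0<θ : 0ℚ ℚ.< θ
      0<θ = *-positive (fromℕ-mono-< 0<r) (recip-positive b)
      0<1-θ : 0ℚ ℚ.< 1ℚ - θ
      0<1-θ = subst (0ℚ ℚ.<_) complement (*-positive (0<- (fromℕ-mono-< r<b)) (recip-positive b))
        where
        lemma : ∀ bℚ r s → (bℚ - r) * s ≡ bℚ * s - r * s
        lemma = solve-∀ ℚ-ring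
        complement : (bℚ - fromℕ r) * recip b ≡ 1ℚ - θ
        complement = trans (lemma bℚ (fromℕ r) (recip b)) (cong (λ z → z - θ) (fromℕ-*-recip b))

    -- If p is a period, then the polynomials for the residues 0 and p modulo b
    -- both agree infinitely often with the one for the residue 0 modulo p.
    period-bound : ∀ q p .{{_ : ℕ.NonZero p}} → QuasipolynomialMod (u (c , d) (suc (suc q))) p → b ℕ.≤ p
    period-bound q p (h , u≡h) = ℕ.≮⇒≥ λ p<b →
      curves-distinct q p (ℕ.n≢0⇒n>0 (ℕ.≢-nonZero⁻¹ p)) p<b λ y →
        trans (cong (λ θ → curve (suc (suc q)) θ y) (sym frac-0))
          (trans (on-residue 0 ℕ.z≤n (ℕ.m*n%n≡0 0 p) y) (sym (on-residue p (ℕ.<⇒≤ p<b) (ℕ.n%n≡0 p) y)))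
      where
      f = u (c , d) (suc (suc q))
      h₀ = h (0 mod p)
      frac-0 : frac 0 ≡ 0ℚ
      frac-0 = ℚ.*-zeroˡ (recip b)
      bℚ = fromℕ b
      on-residue : ∀ r → r ℕ.≤ b → r ℕ.% p ≡ 0 → ∀ y → curve (suc (suc q)) (frac r) y ≡ eval h₀ (y * bℚ)
      on-residue r r≤b r%p≡0 = agreement (curve-deg (suc (suc q)) (frac r))
        (lead-dilate _ bℚ (proj₂ (proj₂ (eval-lead h₀))))
        -- With `t = p * suc s`, the number `n = b * t + r` is divisible by p, since r is, and
        -- `y = t + frac r` lies on the curve for r. The successor keeps n positive also for
        -- `r = 0`, as the polynomials of h are only guaranteed to give the count from n = 1 on.
        (λ s → fromℕ (p ℕ.* suc s) + frac r) injective values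
        where
        injective : ∀ {i j} → fromℕ (p ℕ.* suc i) + frac r ≡ fromℕ (p ℕ.* suc j) + frac r → i ≡ j
        injective {i} {j} eq = ℕ.suc-injective (ℕ.*-cancelˡ-≡ (suc i) (suc j) p
          (fromℕ-injective (+-cancelʳ (frac r) (fromℕ (p ℕ.* suc i)) (fromℕ (p ℕ.* suc j)) eq)))
        values : ∀ s → curve (suc (suc q)) (frac r) (fromℕ (p ℕ.* suc s) + frac r) ≡
                       eval h₀ ((fromℕ (p ℕ.* suc s) + frac r) * bℚ)
        values s = begin
          curve (suc (suc q)) (frac r) (fromℕ t + frac r)   ≡⟨ u-curve (suc (suc q)) t r r≤b ⟨
          fromℕ (f n)                                       ≡⟨ u≡h n 1≤n ⟩
          eval (h (n mod p)) (fromℕ n)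
            ≡⟨ cong₂ (λ ρ x → eval (h ρ) x) n-mod
                 (trans (fromℕ-quotient b t r) (ℚ.*-comm bℚ (fromℕ t + frac r))) ⟩
          eval h₀ ((fromℕ t + frac r) * bℚ)                  ∎
          where
          open ≡-Reasoning
          t = p ℕ.* suc s
          n = b ℕ.* t ℕ.+ r
          1≤n : 1 ℕ.≤ n
          1≤n = ℕ.≤-trans (ℕ.*-mono-≤ (ℕ.n≢0⇒n>0 (ℕ.≢-nonZero⁻¹ b))
                  (ℕ.*-mono-≤ (ℕ.n≢0⇒n>0 (ℕ.≢-nonZero⁻¹ p)) (ℕ.s≤s {n = s} ℕ.z≤n)))
                  (ℕ.m≤m+n (b ℕ.* t) r)
          n%p≡0 : n ℕ.% p ≡ 0 ℕ.% p
          n%p≡0 = begin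
            (b ℕ.* t ℕ.+ r) ℕ.% p
              ≡⟨ cong (ℕ._% p) (trans (ℕ.+-comm (b ℕ.* t) r)
                 (cong (r ℕ.+_) (rearrange b p (suc s)))) ⟩
            (r ℕ.+ b ℕ.* suc s ℕ.* p) ℕ.% p   ≡⟨ ℕ.[m+kn]%n≡m%n r (b ℕ.* suc s) p ⟩
            r ℕ.% p                           ≡⟨ trans r%p≡0 (sym (ℕ.m*n%n≡0 0 p)) ⟩
            0 ℕ.% p                           ∎
            where
            rearrange : ∀ b p s → b ℕ.* (p ℕ.* s) ≡ b ℕ.* s ℕ.* p
            rearrange b p s = trans (cong (b ℕ.*_) (ℕ.*-comm p s)) (sym (ℕ.*-assoc b s p))
          n-mod : n mod p ≡ 0 mod p
          n-mod = Fin.fromℕ<-cong _ _ n%p≡0 (ℕ.m%n<n n p) (ℕ.m%n<n 0 p)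

theorem4p2 : (c d : ℤ) → gcd c d ≡ 1ℤ → (q : ℕ) → 2 ≤ q →
    HasPeriod (u (c , d) q) (∣ c ∣ ⊔ ∣ d ∣)
theorem4p2 c d gcd≡1 (suc (suc q)) (ℕ.s≤s (ℕ.s≤s ℕ.z≤n)) =
  (b≢0 , quasipolynomial (suc (suc q))) , period-bound a<b q
  where
  a = ∣ c ∣ ⊓ ∣ d ∣
  b = ∣ c ∣ ⊔ ∣ d ∣
  coprime : ∀ {k} → k ℕ.∣ ∣ c ∣ → k ℕ.∣ ∣ d ∣ → k ≡ 1
  coprime k∣c k∣d = ℕ.∣1⇒≡1 (subst (_ ℕ.∣_) (ℤ.+-injective gcd≡1) (ℕ.gcd-greatest k∣c k∣d))
  ≢0 : (c , d) ≢ (0ℤ , 0ℤ)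
  ≢0 refl with coprime {2} (2 ℕ.∣0) (2 ℕ.∣0)
  ... | ()
  instance
    b≢0 : ℕ.NonZero b
    b≢0 = ℕ.≢-nonZero λ b≡0 → ≢0 (cong₂ _,_
      (ℤ.∣i∣≡0⇒i≡0 (ℕ.n≤0⇒n≡0 (subst (∣ c ∣ ℕ.≤_) b≡0 (ℕ.m≤m⊔n ∣ c ∣ ∣ d ∣))))
      (ℤ.∣i∣≡0⇒i≡0 (ℕ.n≤0⇒n≡0 (subst (∣ d ∣ ℕ.≤_) b≡0 (ℕ.m≤n⊔m ∣ c ∣ ∣ d ∣)))))
  a≤b : a ℕ.≤ b
  a≤b = ℕ.m⊓n≤m⊔n ∣ c ∣ ∣ d ∣
  -- If a and b were equal, b would divide both coordinates and so be 1. Moves such as (1, 1) have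
  -- `a ≡ b ≡ 1`, hence the guard.
  a<b : 1 ℕ.< b → a ℕ.< b
  a<b 1<b = ℕ.≤∧≢⇒< a≤b λ a≡b → ℕ.<⇒≢ 1<b (sym (coprime
    (ℕ.∣-reflexive (ℕ.≤-antisym (ℕ.≤-trans (ℕ.≤-reflexive (sym a≡b)) (ℕ.m⊓n≤m ∣ c ∣ ∣ d ∣)) (ℕ.m≤m⊔n ∣ c ∣ ∣ d ∣)))
    (ℕ.∣-reflexive (ℕ.≤-antisym (ℕ.≤-trans (ℕ.≤-reflexive (sym a≡b)) (ℕ.m⊓n≤n ∣ c ∣ ∣ d ∣)) (ℕ.m≤n⊔m ∣ c ∣ ∣ d ∣)))))
  -- The lengths of the two coordinates enter the moments only through the product of one function
  -- at both, so they may be sorted.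
  sides : ∀ (F : ℕ → ℚ) → F ∣ c ∣ * F ∣ d ∣ ≡ F a * F b
  sides F with ℕ.≤-total ∣ c ∣ ∣ d ∣
  ... | inj₁ c≤d = cong₂ (λ x y → F x * F y) (sym (ℕ.m≤n⇒m⊓n≡m c≤d)) (sym (ℕ.m≤n⇒m⊔n≡n c≤d))
  ... | inj₂ d≤c = trans (ℚ.*-comm (F ∣ c ∣) (F ∣ d ∣))
    (cong₂ (λ x y → F x * F y) (sym (ℕ.m≥n⇒m⊓n≡n d≤c)) (sym (ℕ.m≥n⇒m⊔n≡m d≤c)))
  open Period c d ≢0 a≤b sides
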